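{- Every graph $G$ without isolated edges can be decomposed into $24$ subgraphs each of which fulfills the 1--2--3 Conjecture.
   Context: All graphs are finite and simple. An isolated edge of a graph is a connected component isomorphic to $K_2$. A decomposition of a graph $G=(V,E)$ into $k$ subgraphs is a partition $E=E_1\cup\dots\cup E_k$ (parts may be empty), the subgraphs being $G_i=(V,E_i)$. For an edge-weighting $\omega:E\to\{1,2,3\}$, the sum at $v$ is $s_\omega(v)=\sum_{e\ni v}\omega(e)$. A graph fulfills the 1--2--3 Conjecture if there exists $\omega:E\to\{1,2,3\}$ with $s_\omega(u)\neq s_\omega(v)$ for every edge $uv$ (an edgeless graph fulfills it trivially). -}

module Defs where

open import Data.Nat using (ℕ; suc)
open import Data.Fin using (Fin; toℕ; _≟_)
open import Data.Bool using (Bool; true; false; _∧_; if_then_else_)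
open import Data.List using (List; map; allFin)
open import Data.Nat.ListAction using (sum)
open import Data.Product using (Σ; _×_)
open import Relation.Nullary using (¬_; does)
open import Relation.Binary.PropositionalEquality using (_≡_)

record Graph (n : ℕ) : Set where
  field
    adj    : Fin n → Fin n → Bool
    sym    : ∀ u v → adj u v ≡ adj v u
    irrefl : ∀ v → adj v v ≡ false
open Graph public

Σv : ∀ {n} → (Fin n → ℕ) → ℕ
Σv {n} f = sum (map f (allFin n))

degree : ∀ {n} → Graph n → Fin n → ℕ
degree G v = Σv (λ u → if adj G u v then 1 else 0)

HasNoIsolatedEdge : ∀ {n} → Graph n → Set
HasNoIsolatedEdge G =
  ∀ u v → adj G u v ≡ true → ¬ (degree G u ≡ 1 × degree G v ≡ 1)

-- Edge weightings with values in {1,2,3}: w u v ∈ Fin 3 encodes weight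
-- suc (toℕ (w u v)); symmetric so that each (unordered) edge gets one weight.
weightVal : Fin 3 → ℕ
weightVal i = suc (toℕ i)

wsum : ∀ {n} → Graph n → (Fin n → Fin n → Fin 3) → Fin n → ℕ
wsum G w v = Σv (λ u → if adj G u v then weightVal (w u v) else 0)

Fulfills123 : ∀ {n} → Graph n → Set
Fulfills123 {n} G =
  Σ (Fin n → Fin n → Fin 3) λ w →
    (∀ u v → w u v ≡ w v u) ×
    (∀ u v → adj G u v ≡ true → ¬ (wsum G w u ≡ wsum G w v))

-- A decomposition of E(G) into k parts is given by a symmetric edge
-- colouring c : edge ↦ Fin k; part i is the spanning subgraph with
-- edge set {uv ∈ E : c u v = i} (parts may be empty).
part : ∀ {n k} (G : Graph n) (c : Fin n → Fin n → Fin k) →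
       (∀ u v → c u v ≡ c v u) → Fin k → Graph n
part G c csym i = record
  { adj    = λ u v → adj G u v ∧ does (c u v ≟ i)
  ; sym    = λ u v → lemma u v
  ; irrefl = λ v → lemma2 v
  }
  where
  open import Relation.Binary.PropositionalEquality using (cong₂; cong; refl)
  lemma : ∀ u v → (adj G u v ∧ does (c u v ≟ i)) ≡ (adj G v u ∧ does (c v u ≟ i))
  lemma u v = cong₂ _∧_ (sym G u v) (cong (λ x → does (x ≟ i)) (csym u v))
  lemma2 : ∀ v → (adj G v v ∧ does (c v v ≟ i)) ≡ false
  lemma2 v with adj G v v | irrefl G v
  ... | false | refl = refl

{-# OPTIONS --safe #-}
module Submission where

-- Colour the vertices by 0, 1, 2 so that every vertex has at most as many neighbours in its own
-- class as in each other class, and orient the edges between classes cyclically.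
--
-- Edges inside class j, weighted so that every vertex they meet has a sum nonzero modulo 3, form a
-- part together with some edges of weight 3 leaving class j or ending at a leaf. The choice of the
-- latter does not change residues, and there are enough of them to separate adjacent vertices of
-- class j greedily; all other vertices of the part are 0 modulo 3.
--
-- The remaining edges L are treated as a bipartite graph between tails p and heads q. Assign tails
-- to out-neighbours such that no head receives exactly one tail and no head is adjacent to two
-- unassigned tails. At an assigned tail all edges get weight 3, except that the edges to the
-- assigned heads get 1 or 2 with sum 0 modulo 3 at each head: tails are nonzero, heads are 0. At the
-- unassigned tails L consists of disjoint stars, which are harmless if they have two edges or their
-- only head has a further in-neighbour. What is left are the edges isolated in the bipartite graph
-- of their class. Those touching another such edge form paths and cycles, which the weights 1, 2, 3
-- given by the class of the tail distinguish. Every other one is adjacent to an edge of another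
-- part, and is attached to that part as a pendant edge.

open import Defs
open import Data.Nat using (ℕ; zero; suc; _+_; _*_; _∸_; _≤_; _<_; z≤n; s≤s)
import Data.Nat as ℕ
open import Data.Nat.Properties hiding (_≟_)
open import Data.Nat.Divisibility using (_∣_; _∣?_; ∣m∣n⇒∣m+n; ∣m+n∣m⇒∣n; _∣0; ∣-refl; n∣m*n)
open import Data.Nat.Induction using (<-wellFounded)
import Data.Nat.ListAction as ListAction
open import Induction.WellFounded using (Acc; acc)
open import Data.Bool using (Bool; true; false; _∧_; not; if_then_else_)
import Data.Bool as Bool
open import Data.Bool.Properties using (∧-zeroʳ)
open import Data.Fin using (Fin; zero; suc; _≟_; punchIn; punchOut; combine)
open import Data.Fin.Patterns
open import Data.Fin.Properties
  using (any?; all?; punchInᵢ≢i; punchIn-punchOut; combine-injective; toℕ-injective; toℕ<n)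
open import Data.List using (map; tabulate)
open import Data.List.Properties using (map-tabulate)
open import Data.Maybe using (Maybe; just; nothing)
import Data.Maybe as Maybe
open import Data.Maybe.Properties using (just-injective) renaming (≡-dec to Maybe-≡-dec)
open import Data.Product using (Σ; ∃; _×_; _,_; proj₁; proj₂)
open import Data.Sum using (_⊎_; inj₁; inj₂; [_,_]′)
open import Data.Empty using (⊥; ⊥-elim)
open import Function using (_∘_; case_of_)
open import Relation.Nullary using (¬_; Dec; yes; no; does; contradiction)
open import Relation.Nullary.Decidable
  using (_×-dec_; _⊎-dec_; _→-dec_; ¬?; dec-true; dec-false; from-no)
open import Relation.Binary.PropositionalEquality hiding ([_]) renaming (sym to ≡-sym)
open import Algebra.Properties.CommutativeMonoid.Sum +-0-commutativeMonoid
  using (sum; sum-cong-≗; ∑-distrib-+; sum-remove; sum-replicate-zero)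
open import Algebra.Properties.Semiring.Sum +-*-semiring using (*-distribʳ-sum)

private variable
  n : ℕ

-- Finite sums and counts.

Σv≡sum : (f : Fin n → ℕ) → Σv f ≡ sum f
Σv≡sum {zero}  f = refl
Σv≡sum {suc n} f = cong (f zero +_) (begin
  ListAction.sum (map f (tabulate suc))
    ≡⟨ cong ListAction.sum (trans (map-tabulate suc f) (≡-sym (map-tabulate (λ i → i) (f ∘ suc)))) ⟩
  Σv (f ∘ suc)  ≡⟨ Σv≡sum (f ∘ suc) ⟩
  sum (f ∘ suc) ∎)
  where
  open ≡-Reasoning

𝟙 : Bool → ℕ
𝟙 b = if b then 1 else 0

count : (Fin n → Bool) → ℕ
count b = sum (λ y → 𝟙 (b y))

sum-zero : (f : Fin n → ℕ) → (∀ y → f y ≡ 0) → sum f ≡ 0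
sum-zero {n} f f≡0 = trans (sum-cong-≗ f≡0) (sum-replicate-zero n)

sum-single : (f : Fin n → ℕ) (v : Fin n) → (∀ y → y ≢ v → f y ≡ 0) → sum f ≡ f v
sum-single {suc n} f v f≡0 = begin
  sum f                            ≡⟨ sum-remove {i = v} f ⟩
  f v + sum (λ y → f (punchIn v y)) ≡⟨ cong (f v +_) (sum-zero _ λ y → f≡0 _ (punchInᵢ≢i v y)) ⟩
  f v + 0                          ≡⟨ +-identityʳ _ ⟩
  f v                              ∎
  where open ≡-Reasoning

-- Each side carries the other function's term at `x`, which expresses the change of a single term
-- without subtraction.
sum-differ : (f g : Fin n → ℕ) (x : Fin n) → (∀ y → y ≢ x → f y ≡ g y) →
             sum f + g x ≡ sum g + f x
sum-differ {suc n} f g x f≡g = begin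
  sum f + g x       ≡⟨ cong (_+ g x) (sum-remove {i = x} f) ⟩
  f x + rest f + g x ≡⟨ cong (λ r → f x + r + g x) (sum-cong-≗ λ y → f≡g _ (punchInᵢ≢i x y)) ⟩
  f x + rest g + g x ≡⟨ +-assoc (f x) _ _ ⟩
  f x + (rest g + g x) ≡⟨ +-comm (f x) _ ⟩
  rest g + g x + f x ≡⟨ cong (_+ f x) (+-comm (rest g) _) ⟩
  g x + rest g + f x ≡⟨ cong (_+ f x) (sum-remove {i = x} g) ⟨
  sum g + f x       ∎
  where
  open ≡-Reasoning
  rest : (Fin (suc n) → ℕ) → ℕ
  rest h = sum (λ y → h (punchIn x y))

member≤sum : (f : Fin n → ℕ) (y : Fin n) → f y ≤ sum f
member≤sum {suc n} f y = ≤-trans (m≤m+n (f y) _) (≤-reflexive (≡-sym (sum-remove {i = y} f)))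

two-members≤sum : (f : Fin n → ℕ) {x y : Fin n} → x ≢ y → f x + f y ≤ sum f
two-members≤sum {suc n} f {x} {y} x≢y = begin
  f x + f y                         ≡⟨ cong (λ z → f x + f z) (punchIn-punchOut x≢y) ⟨
  f x + f (punchIn x (punchOut x≢y)) ≤⟨ +-monoʳ-≤ (f x) (member≤sum (f ∘ punchIn x) _) ⟩
  f x + sum (f ∘ punchIn x)         ≡⟨ sum-remove {i = x} f ⟨
  sum f                             ∎
  where open ≤-Reasoning

∣-sum : ∀ {d} (f : Fin n → ℕ) → (∀ y → d ∣ f y) → d ∣ sum f
∣-sum {zero}  f d∣f = _ ∣0
∣-sum {suc n} f d∣f = ∣m∣n⇒∣m+n (d∣f zero) (∣-sum (f ∘ suc) (d∣f ∘ suc))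

∃-nonzero : (f : Fin n → ℕ) → sum f ≢ 0 → ∃ λ y → f y ≢ 0
∃-nonzero f s≢0 with any? (λ y → ¬? (f y ℕ.≟ 0))
... | yes p = p
... | no ¬p = contradiction (sum-zero f zeros) s≢0
  where
  zeros : ∀ y → f y ≡ 0
  zeros y with f y ℕ.≟ 0
  ... | yes e = e
  ... | no  e = contradiction (y , e) ¬p

sum≤-unique : ∀ {c} (f : Fin n → ℕ) → (∀ {x y} → f x ≢ 0 → f y ≢ 0 → x ≡ y) →
              (∀ y → f y ≤ c) → sum f ≤ c
sum≤-unique {c = c} f unique f≤c with sum f ℕ.≟ 0
... | yes e = subst (_≤ c) (≡-sym e) z≤n
... | no  e with ∃-nonzero f e
...   | v , fv≢0 = subst (_≤ c) (≡-sym (sum-single f v others)) (f≤c v)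
  where
  others : ∀ y → y ≢ v → f y ≡ 0
  others y y≢v with f y ℕ.≟ 0
  ... | yes e′ = e′
  ... | no  e′ = contradiction (unique e′ fv≢0) y≢v

count-witness : (b : Fin n → Bool) → count b ≢ 0 → ∃ λ y → b y ≡ true
count-witness b c≢0 with ∃-nonzero _ c≢0
... | y , p with b y in eq
...   | true  = y , eq
...   | false = contradiction refl p

count-pos : (b : Fin n → Bool) {y : Fin n} → b y ≡ true → 1 ≤ count b
count-pos b {y} by = subst (_≤ count b) (cong 𝟙 by) (member≤sum (𝟙 ∘ b) y)

does-≟-sym : (a b : Fin n) → does (a ≟ b) ≡ does (b ≟ a)
does-≟-sym a b with a ≟ b
... | yes e   = ≡-sym (dec-true (b ≟ a) (≡-sym e))
... | no  a≢b = ≡-sym (dec-false (b ≟ a) (a≢b ∘ ≡-sym))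

next : Fin 3 → Fin 3
next 0F = 1F
next 1F = 2F
next 2F = 0F

-- A vertex colouring with three classes that no single recolouring improves.

module LocalMaxCut (G : Graph n) where

  nbrs : (Fin n → Fin 3) → Fin n → Fin 3 → ℕ
  nbrs col v j = count (λ u → adj G v u ∧ does (col u ≟ j))

  LocallyMaximal : (Fin n → Fin 3) → Set
  LocallyMaximal col = ∀ v j → nbrs col v (col v) ≤ nbrs col v j

  row : (Fin n → Fin 3) → Fin n → ℕ
  row col u = nbrs col u (col u)

  -- Counts every monochromatic edge twice, once from either end; this is the potential of the local
  -- search.
  monochromatic : (Fin n → Fin 3) → ℕ
  monochromatic col = sum (row col)

  recolour : (Fin n → Fin 3) → Fin n → Fin 3 → Fin n → Fin 3
  recolour col x j y = if does (y ≟ x) then j else col y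

  recolour-here : ∀ col x j → recolour col x j x ≡ j
  recolour-here col x j rewrite dec-true (x ≟ x) refl = refl

  recolour-there : ∀ col x j {y} → y ≢ x → recolour col x j y ≡ col y
  recolour-there col x j {y} y≢x rewrite dec-false (y ≟ x) y≢x = refl

  -- Recolouring `x` replaces `own` by `other` in the row of `x` and, adjacency being symmetric,
  -- makes the same change in the total of the other rows, so the potential drops by twice the
  -- difference. Adding `own` on both sides avoids subtraction.
  recolour-decreases : ∀ col x j → nbrs col x j < nbrs col x (col x) →
                       monochromatic (recolour col x j) < monochromatic col
  recolour-decreases col x j lt = +-cancelʳ-< (nbrs col x (col x)) _ _ (begin-strict
    Φ′ + own                ≡⟨ cong (_+ own) (sum-remove-x (row col′)) ⟩
    row col′ x + rest (row col′) + own  ≡⟨ cong (λ r → r + rest (row col′) + own) row-x ⟩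
    other + rest (row col′) + own  ≡⟨ +-assoc other _ _ ⟩
    other + (rest (row col′) + own)  ≡⟨ cong (other +_) rests ⟩
    other + (rest (row col) + other)  <⟨ +-mono-< lt (+-monoʳ-< (rest (row col)) lt) ⟩
    own + (rest (row col) + own)    ≡⟨ +-assoc own _ _ ⟨
    own + rest (row col) + own  ≡⟨ cong (_+ own) (sum-remove-x (row col)) ⟨
    monochromatic col + own ∎)
    where
    open ≤-Reasoning
    col′ = recolour col x j
    Φ′ = monochromatic col′
    own = nbrs col x (col x)
    other = nbrs col x j

    rest : (Fin n → ℕ) → ℕ
    rest f = sum (λ y → if does (y ≟ x) then 0 else f y)

    sum-remove-x : ∀ f → sum f ≡ f x + rest f
    sum-remove-x f = begin-equality
      sum f       ≡⟨ +-identityʳ _ ⟨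
      sum f + 0   ≡⟨ cong (sum f +_) at-x ⟨
      sum f + (if does (x ≟ x) then 0 else f x) ≡⟨ sum-differ f _ x away ⟩
      rest f + f x ≡⟨ +-comm (rest f) _ ⟩
      f x + rest f ∎
      where
      at-x : (if does (x ≟ x) then 0 else f x) ≡ 0
      at-x rewrite dec-true (x ≟ x) refl = refl
      away : ∀ y → y ≢ x → f y ≡ (if does (y ≟ x) then 0 else f y)
      away y y≢x rewrite dec-false (y ≟ x) y≢x = refl

    row-x : row col′ x ≡ other
    row-x = sum-cong-≗ λ u → cong 𝟙 (entry u)
      where
      entry : ∀ u → (adj G x u ∧ does (col′ u ≟ col′ x)) ≡ (adj G x u ∧ does (col u ≟ j))
      entry u with u ≟ x
      ... | yes refl rewrite irrefl G u = refl
      ... | no  u≢x  rewrite recolour-here col x j = refl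

    -- By symmetry the column of `x` equals its row; the term left out at `x` itself is 0 by
    -- irreflexivity.
    rest-nbrs : ∀ i → rest (λ u → 𝟙 (adj G u x ∧ does (i ≟ col u))) ≡ nbrs col x i
    rest-nbrs i = sum-cong-≗ entry
      where
      entry : ∀ u → (if does (u ≟ x) then 0 else 𝟙 (adj G u x ∧ does (i ≟ col u)))
                    ≡ 𝟙 (adj G x u ∧ does (col u ≟ i))
      entry u with u ≟ x
      ... | yes refl rewrite irrefl G u = refl
      ... | no  u≢x  = cong 𝟙 (cong₂ _∧_ (Graph.sym G u x) (does-≟-sym i (col u)))

    row-differ : ∀ u → u ≢ x → row col′ u + 𝟙 (adj G u x ∧ does (col x ≟ col u))
                              ≡ row col u + 𝟙 (adj G u x ∧ does (j ≟ col u))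
    row-differ u u≢x = subst₂ (λ a b → row col′ u + 𝟙 (adj G u x ∧ does (col x ≟ col u)) ≡ row col u + 𝟙 (adj G u x ∧ does (a ≟ b)))
      (recolour-here col x j) (recolour-there col x j u≢x)
      (sum-differ (λ v → 𝟙 (adj G u v ∧ does (col′ v ≟ col′ u))) (λ v → 𝟙 (adj G u v ∧ does (col v ≟ col u))) x
        λ v v≢x → cong₂ (λ a b → 𝟙 (adj G u v ∧ does (a ≟ b))) (recolour-there col x j v≢x) (recolour-there col x j u≢x))

    rest-+ : ∀ f g → rest (λ u → f u + g u) ≡ rest f + rest g
    rest-+ f g = trans (sum-cong-≗ entry) (∑-distrib-+ {n} _ _)
      where
      entry : ∀ u → (if does (u ≟ x) then 0 else f u + g u)
                  ≡ (if does (u ≟ x) then 0 else f u) + (if does (u ≟ x) then 0 else g u)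
      entry u with u ≟ x
      ... | yes _ = refl
      ... | no  _ = refl

    rest-cong : ∀ f g → (∀ u → u ≢ x → f u ≡ g u) → rest f ≡ rest g
    rest-cong f g f≡g = sum-cong-≗ entry
      where
      entry : ∀ u → (if does (u ≟ x) then 0 else f u) ≡ (if does (u ≟ x) then 0 else g u)
      entry u with u ≟ x
      ... | yes _   = refl
      ... | no  u≢x = f≡g u u≢x

    rests : rest (row col′) + own ≡ rest (row col) + other
    rests = begin-equality
      rest (row col′) + own   ≡⟨ cong (rest (row col′) +_) (rest-nbrs (col x)) ⟨
      rest (row col′) + rest (λ u → 𝟙 (adj G u x ∧ does (col x ≟ col u))) ≡⟨ rest-+ (row col′) _ ⟨
      rest (λ u → row col′ u + 𝟙 (adj G u x ∧ does (col x ≟ col u))) ≡⟨ rest-cong _ _ row-differ ⟩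
      rest (λ u → row col u + 𝟙 (adj G u x ∧ does (j ≟ col u))) ≡⟨ rest-+ (row col) _ ⟩
      rest (row col) + rest (λ u → 𝟙 (adj G u x ∧ does (j ≟ col u))) ≡⟨ cong (rest (row col) +_) (rest-nbrs j) ⟩
      rest (row col) + other  ∎

  improve : ∀ col → Acc _<_ (monochromatic col) → Σ (Fin n → Fin 3) LocallyMaximal
  improve col (acc rec) with any? (λ v → any? λ j → nbrs col v j <? nbrs col v (col v))
  ... | yes (v , j , lt) = improve (recolour col v j) (rec (recolour-decreases col v j lt))
  ... | no  ¬lt = col , λ v j → ≮⇒≥ λ lt → ¬lt (v , j , lt)

  locallyMaximal : Σ (Fin n → Fin 3) LocallyMaximal
  locallyMaximal = improve (λ _ → 0F) (<-wellFounded _)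

-- Weights modulo 3.

drop3 : ∀ {x} → ¬ 3 ∣ x → ¬ 3 ∣ 3 + x
drop3 ¬d d = ¬d (∣m+n∣m⇒∣n d ∣-refl)

-- The weights 1, 2, 3 represent all residues modulo 3 and each condition excludes exactly one of
-- them, so a weight is left.
avoidTwo : ∀ a b → ∃ λ h → ¬ 3 ∣ a + weightVal h × ¬ 3 ∣ b + weightVal h
avoidTwo 0 0 = 0F , from-no (3 ∣? 1) , from-no (3 ∣? 1)
avoidTwo 0 1 = 0F , from-no (3 ∣? 1) , from-no (3 ∣? 2)
avoidTwo 0 2 = 1F , from-no (3 ∣? 2) , from-no (3 ∣? 4)
avoidTwo 1 0 = 0F , from-no (3 ∣? 2) , from-no (3 ∣? 1)
avoidTwo 1 1 = 0F , from-no (3 ∣? 2) , from-no (3 ∣? 2)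
avoidTwo 1 2 = 2F , from-no (3 ∣? 4) , from-no (3 ∣? 5)
avoidTwo 2 0 = 1F , from-no (3 ∣? 4) , from-no (3 ∣? 2)
avoidTwo 2 1 = 2F , from-no (3 ∣? 5) , from-no (3 ∣? 4)
avoidTwo 2 2 = 1F , from-no (3 ∣? 4) , from-no (3 ∣? 4)
avoidTwo (suc (suc (suc a))) b = let h , p , q = avoidTwo a b in h , drop3 p , q
avoidTwo a (suc (suc (suc b))) = let h , p , q = avoidTwo a b in h , p , drop3 q

-- The residue that completes `s` to 0 is itself nonzero, hence that of weight 1 or 2.
complete3 : ∀ s → ¬ 3 ∣ s → ∃ λ h → ¬ 3 ∣ weightVal h × 3 ∣ s + weightVal h
complete3 0 ¬d = contradiction (3 ∣0) ¬d
complete3 1 _  = 1F , from-no (3 ∣? 2) , ∣-refl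
complete3 2 _  = 0F , from-no (3 ∣? 1) , ∣-refl
complete3 (suc (suc (suc s))) ¬d =
  let h , p , q = complete3 s (¬d ∘ ∣m∣n⇒∣m+n ∣-refl) in h , p , ∣m∣n⇒∣m+n ∣-refl q

-- One step of `nonzeroWeights`: `b` marks the neighbours of a new vertex and `r` holds their sums
-- so far. In the last condition the premise on `y` expresses that the star is nonempty.
starWeights : (b : Fin n → Bool) (r : Fin n → ℕ) → ∃ λ (w : Fin n → Fin 3) →
              (∀ y → b y ≡ true → ¬ 3 ∣ weightVal (w y) + r y) ×
              (∀ y → b y ≡ true → ¬ 3 ∣ sum (λ y → if b y then weightVal (w y) else 0))
starWeights {zero}  b r = (λ ()) , (λ ()) , (λ ())
starWeights {suc n} b r = go (b zero) refl
  where
  open Σ (starWeights (b ∘ suc) (r ∘ suc)) renaming (proj₁ to w; proj₂ to w-ok)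
  T : ℕ
  T = sum (λ y → if b (suc y) then weightVal (w y) else 0)
  w′ : Fin 3 → Fin (suc n) → Fin 3
  w′ h zero    = h
  w′ h (suc y) = w y
  go : ∀ c → b zero ≡ c → ∃ λ (w : Fin (suc n) → Fin 3) →
       (∀ y → b y ≡ true → ¬ 3 ∣ weightVal (w y) + r y) ×
       (∀ y → b y ≡ true → ¬ 3 ∣ sum (λ y → if b y then weightVal (w y) else 0))
  go false eq = w′ 0F , old , new
    where
    old : ∀ y → b y ≡ true → ¬ 3 ∣ weightVal (w′ 0F y) + r y
    old zero    e = case trans (≡-sym eq) e of λ ()
    old (suc y) e = proj₁ w-ok y e
    new : ∀ y → b y ≡ true → ¬ 3 ∣ sum (λ y → if b y then weightVal (w′ 0F y) else 0)
    new zero    e = case trans (≡-sym eq) e of λ ()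
    new (suc y) e = subst (λ c → ¬ 3 ∣ (if c then 1 else 0) + T) (≡-sym eq) (proj₂ w-ok y e)
  go true eq =
    -- The edge to `zero` is weighted last: it must cancel neither the sum `r zero` at its old end
    -- nor the sum `T` of the other new edges.
    let h , p , q = avoidTwo (r zero) T in
    w′ h ,
    (λ { zero    e d → p (subst (3 ∣_) (+-comm (weightVal h) _) d)
       ; (suc y) e   → proj₁ w-ok y e }) ,
    (λ y e → subst (λ c → ¬ 3 ∣ (if c then weightVal h else 0) + T) (≡-sym eq)
      (λ d → q (subst (3 ∣_) (+-comm (weightVal h) T) d)))

-- Adding the vertices one at a time, each new edge has two weights keeping its old end nonzero,
-- and the last new edge can use this freedom to make the new vertex nonzero as well.
nonzeroWeights : (h : Fin n → Fin n → Bool) → (∀ u v → h u v ≡ h v u) → (∀ v → h v v ≡ false) →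
  ∃ λ (g : Fin n → Fin n → Fin 3) → (∀ u v → g u v ≡ g v u) ×
          (∀ u v → h u v ≡ true → ¬ 3 ∣ sum (λ y → if h u y then weightVal (g u y) else 0))
nonzeroWeights {zero}  h h-sym h-irr = (λ ()) , (λ ()) , (λ ())
nonzeroWeights {suc n} h h-sym h-irr
  with nonzeroWeights (λ u v → h (suc u) (suc v)) (λ u v → h-sym (suc u) (suc v)) (h-irr ∘ suc)
... | g , g-sym , g-nz with starWeights (h zero ∘ suc) (λ u → sum (λ y → if h (suc u) (suc y) then weightVal (g u y) else 0))
...   | w , old , new = g′ , g′-sym , nz
  where
  g′ : Fin (suc n) → Fin (suc n) → Fin 3
  g′ zero    zero    = 0F
  g′ zero    (suc v) = w v
  g′ (suc u) zero    = w u
  g′ (suc u) (suc v) = g u v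
  g′-sym : ∀ u v → g′ u v ≡ g′ v u
  g′-sym zero    zero    = refl
  g′-sym zero    (suc v) = refl
  g′-sym (suc u) zero    = refl
  g′-sym (suc u) (suc v) = g-sym u v
  nz : ∀ u v → h u v ≡ true → ¬ 3 ∣ sum (λ y → if h u y then weightVal (g′ u y) else 0)
  nz zero zero e = case trans (≡-sym (h-irr zero)) e of λ ()
  nz zero (suc v) e rewrite h-irr zero = new v e
  nz (suc u) v e with h (suc u) zero in eq
  nz (suc u) v       e | true  = old u (trans (h-sym zero (suc u)) eq)
  nz (suc u) zero    e | false = case trans (≡-sym eq) e of λ ()
  nz (suc u) (suc v) e | false = g-nz u v e

-- Greedy choice of the number of additional weights 3.

count-split : (b c : Fin n → Bool) → count b ≡ count (λ y → b y ∧ c y) + count (λ y → b y ∧ not (c y))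
count-split b c = trans (sum-cong-≗ (λ y → entry (b y) (c y))) (∑-distrib-+ (λ y → 𝟙 (b y ∧ c y)) _)
  where
  entry : ∀ x y → 𝟙 x ≡ 𝟙 (x ∧ y) + 𝟙 (x ∧ not y)
  entry true  true  = refl
  entry true  false = refl
  entry false _     = refl

-- There are `c + 1` values of `t` against at most `c` forbidden ones. If the largest `t` is hit,
-- all elements hitting it, at least one, are discarded and the search continues below.
avoid : (b : Fin n → Bool) (val : Fin n → ℕ) (base c : ℕ) → count b ≤ c →
        ∃ λ t → t ≤ c × (∀ y → b y ≡ true → base + t * 3 ≢ val y)
avoid b val base c le with any? (λ y → (b y Bool.≟ true) ×-dec (val y ℕ.≟ base + c * 3))
... | no  ¬bad = c , ≤-refl , λ y by e → ¬bad (y , by , ≡-sym e)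
avoid b val base zero le | yes (y , by , _) = contradiction (≤-trans (count-pos b by) le) λ ()
avoid b val base (suc c) le | yes (y , by , e) =
  t , m≤n⇒m≤1+n t≤c , fresh
  where
  hit : Fin _ → Bool
  hit z = does (val z ℕ.≟ base + suc c * 3)
  rest : count (λ z → b z ∧ not (hit z)) ≤ c
  rest = +-cancelˡ-≤ 1 _ _ (begin
    1 + count (λ z → b z ∧ not (hit z)) ≤⟨ +-monoˡ-≤ _ (count-pos (λ z → b z ∧ hit z) {y} (cong₂ _∧_ by (dec-true (val y ℕ.≟ _) e))) ⟩
    count (λ z → b z ∧ hit z) + count (λ z → b z ∧ not (hit z)) ≡⟨ count-split b hit ⟨
    count b ≤⟨ le ⟩
    suc c ∎)
    where open ≤-Reasoning
  ih : ∃ λ t → t ≤ c × (∀ z → b z ∧ not (hit z) ≡ true → base + t * 3 ≢ val z)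
  ih = avoid _ val base c rest
  t : ℕ
  t = proj₁ ih
  t≤c : t ≤ c
  t≤c = proj₁ (proj₂ ih)
  fresh : ∀ z → b z ≡ true → base + t * 3 ≢ val z
  fresh z bz ez with val z ℕ.≟ base + suc c * 3
  ... | yes hz = <⇒≢ (s≤s t≤c) (*-cancelʳ-≡ t (suc c) 3 (+-cancelˡ-≡ base _ _ (trans ez hz)))
  ... | no  hz = proj₂ (proj₂ ih) z (cong₂ _∧_ bz (cong not (dec-false (val z ℕ.≟ _) hz))) ez

-- Greedy: vertex `zero` is treated after all the others and has `cap zero + 1` levels to choose
-- from, of which each neighbour excludes at most one and `slack` one more. Levels enter with the
-- factor 3, so the residues remain those of `base`.
distinguish : (h : Fin n → Fin n → Bool) → (∀ u v → h u v ≡ h v u) → (∀ v → h v v ≡ false) →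
  (base cap : Fin n → ℕ) (slack : Fin n → Bool) → (∀ v → 𝟙 (slack v) + count (h v) ≤ cap v) →
  ∃ λ (t : Fin n → ℕ) → (∀ v → t v ≤ cap v) ×
          (∀ v → slack v ≡ true → suc (t v) ≢ cap v) ×
          (∀ u v → h u v ≡ true → base u + t u * 3 ≢ base v + t v * 3)
distinguish {zero}  h h-sym h-irr base cap slack le = (λ ()) , (λ ()) , (λ ()) , (λ ())
distinguish {suc n} h h-sym h-irr base cap slack le
  with distinguish (λ u v → h (suc u) (suc v)) (λ u v → h-sym (suc u) (suc v)) (h-irr ∘ suc)
         (base ∘ suc) (cap ∘ suc) (slack ∘ suc)
         (λ v → ≤-trans (+-monoʳ-≤ (𝟙 (slack (suc v))) (m≤n+m _ (𝟙 (h (suc v) zero)))) (le (suc v)))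
... | t , t≤ , t-slack , t-dist = t′ , t′≤ , t′-slack , t′-dist
  where
  -- No vertex is its own neighbour, so slot `zero` is free to carry the extra forbidden value, that
  -- of level `cap zero ∸ 1`.
  forbidden : Fin (suc n) → Bool
  forbidden zero    = slack zero
  forbidden (suc y) = h zero (suc y)
  val : Fin (suc n) → ℕ
  val zero    = base zero + (cap zero ∸ 1) * 3
  val (suc y) = base (suc y) + t y * 3
  new : ∃ λ s → s ≤ cap zero × (∀ y → forbidden y ≡ true → base zero + s * 3 ≢ val y)
  new = avoid forbidden val (base zero) (cap zero)
    (≤-trans (+-monoʳ-≤ (𝟙 (slack zero)) (m≤n+m _ (𝟙 (h zero zero)))) (le zero))
  t′ : Fin (suc n) → ℕ
  t′ zero    = proj₁ new
  t′ (suc v) = t v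
  t′≤ : ∀ v → t′ v ≤ cap v
  t′≤ zero    = proj₁ (proj₂ new)
  t′≤ (suc v) = t≤ v
  t′-slack : ∀ v → slack v ≡ true → suc (t′ v) ≢ cap v
  t′-slack zero    e eq = proj₂ (proj₂ new) zero e (cong (λ x → base zero + (x ∸ 1) * 3) eq)
  t′-slack (suc v) e = t-slack v e
  t′-dist : ∀ u v → h u v ≡ true → base u + t′ u * 3 ≢ base v + t′ v * 3
  t′-dist zero    zero    e = case trans (≡-sym (h-irr zero)) e of λ ()
  t′-dist zero    (suc v) e = proj₂ (proj₂ new) (suc v) e
  t′-dist (suc u) zero    e = proj₂ (proj₂ new) (suc u) (trans (h-sym zero (suc u)) e) ∘ ≡-sym
  t′-dist (suc u) (suc v) e = t-dist u v e

subset : (b : Fin n → Bool) (t : ℕ) → t ≤ count b →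
         ∃ λ (s : Fin n → Bool) → (∀ y → s y ≡ true → b y ≡ true) × count s ≡ t
subset {n} b zero le = (λ _ → false) , (λ _ ()) , sum-zero {n} _ (λ _ → refl)
subset {suc n} b (suc t) le with b zero in eq
... | true  = s′ , sub , cong suc (proj₂ (proj₂ ih))
  where
  ih : ∃ λ s → (∀ y → s y ≡ true → b (suc y) ≡ true) × count s ≡ t
  ih = subset (b ∘ suc) t (≤-pred le)
  s′ : Fin (suc n) → Bool
  s′ zero    = true
  s′ (suc y) = proj₁ ih y
  sub : ∀ y → s′ y ≡ true → b y ≡ true
  sub zero    _ = eq
  sub (suc y) e = proj₁ (proj₂ ih) y e
... | false = s′ , sub , proj₂ (proj₂ ih)
  where
  ih : ∃ λ s → (∀ y → s y ≡ true → b (suc y) ≡ true) × count s ≡ suc t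
  ih = subset (b ∘ suc) (suc t) le
  s′ : Fin (suc n) → Bool
  s′ zero    = false
  s′ (suc y) = proj₁ ih y
  sub : ∀ y → s′ y ≡ true → b y ≡ true
  sub (suc y) e = proj₁ (proj₂ ih) y e

-- If `y` were the only omitted element, `b` would have exactly one element more than `s`.
another-omitted : (b s : Fin n → Bool) → (∀ y → s y ≡ true → b y ≡ true) → suc (count s) ≢ count b →
  ∀ {y} → b y ≡ true → s y ≡ false → ∃ λ y′ → y′ ≢ y × b y′ ≡ true × s y′ ≡ false
another-omitted b s sub ne {y} by sy
  with any? (λ y′ → ¬? (y′ ≟ y) ×-dec (b y′ Bool.≟ true) ×-dec (s y′ Bool.≟ false))
... | yes p = p
... | no ¬p = contradiction (≡-sym (begin
  count b ≡⟨ count-split b s ⟩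
  count (λ z → b z ∧ s z) + count (λ z → b z ∧ not (s z))
    ≡⟨ cong₂ _+_ (sum-cong-≗ (cong 𝟙 ∘ inside)) (trans (sum-single (λ z → 𝟙 (b z ∧ not (s z))) y outside) at-y) ⟩
  count s + 1 ≡⟨ +-comm (count s) 1 ⟩
  suc (count s) ∎)) ne
  where
  open ≡-Reasoning
  inside : ∀ z → b z ∧ s z ≡ s z
  inside z with s z in sz
  ... | true  rewrite sub z sz = refl
  ... | false = ∧-zeroʳ (b z)
  at-y : 𝟙 (b y ∧ not (s y)) ≡ 1
  at-y rewrite by | sy = refl
  outside : ∀ z → z ≢ y → 𝟙 (b z ∧ not (s z)) ≡ 0
  outside z z≢y with b z in bz | s z in sz
  ... | true  | true  = refl
  ... | true  | false = contradiction (z , z≢y , bz , sz) ¬p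
  ... | false | _     = refl

-- Assigning tails to heads.

record PartialAssignment {a b : ℕ} (L : Fin a → Fin b → Set) : Set where
  field
    to       : Fin a → Maybe (Fin b)
    sound    : ∀ {p q} → to p ≡ just q → L p q
    shared   : ∀ {p q} → to p ≡ just q → ∃ λ p′ → p′ ≢ p × to p′ ≡ just q
    unique   : ∀ {p p′ q} → L p q → L p′ q → to p ≡ nothing → to p′ ≡ nothing → p ≡ p′

-- Induction on the heads. If the first head has two tails, all its tails are assigned to it.
-- Otherwise it receives none, and `unique` holds there because it has at most one tail altogether.
partialAssignment : ∀ {a b} (L : Fin a → Fin b → Set) → (∀ p q → Dec (L p q)) → PartialAssignment L
partialAssignment {b = zero} L L? = record
  { to = λ _ → nothing ; sound = λ () ; shared = λ () ; unique = λ { {q = ()} } }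
partialAssignment {a} {suc b} L L?
  with any? (λ p → any? λ p′ → ¬? (p′ ≟ p) ×-dec L? p zero ×-dec L? p′ zero)
... | no ¬two = record
  { to = to′
  ; sound = sound′ ; shared = shared′ ; unique = unique′ }
  where
  open PartialAssignment (partialAssignment (λ p q → L p (suc q)) (λ p q → L? p (suc q)))
  to′ : Fin a → Maybe (Fin (suc b))
  to′ p = Maybe.map suc (to p)
  sound′ : ∀ {p q} → to′ p ≡ just q → L p q
  sound′ {p} e with to p in eq
  sound′ {p} refl | just q = sound eq
  shared′ : ∀ {p q} → to′ p ≡ just q → ∃ λ p′ → p′ ≢ p × to′ p′ ≡ just q
  shared′ {p} e with to p in eq
  shared′ {p} refl | just q = let p′ , ne , e′ = shared eq in p′ , ne , cong (Maybe.map suc) e′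
  unassigned : ∀ {p} → to′ p ≡ nothing → to p ≡ nothing
  unassigned {p} e with to p
  ... | nothing = refl
  unique′ : ∀ {p p′ q} → L p q → L p′ q → to′ p ≡ nothing → to′ p′ ≡ nothing → p ≡ p′
  unique′ {p} {p′} {suc q} l l′ e e′ = unique l l′ (unassigned e) (unassigned e′)
  unique′ {p} {p′} {zero} l l′ _ _ with p′ ≟ p
  ... | yes p′≡p = ≡-sym p′≡p
  ... | no  p′≢p = contradiction (p , p′ , p′≢p , l , l′) ¬two
... | yes (p₁ , p₂ , p₂≢p₁ , l₁ , l₂) = record
  { to = to′ ; sound = sound′ ; shared = shared′ ; unique = unique′ }
  where
  -- The tails of the first head are withdrawn from the relation before the other heads are treated,
  -- so the two assignments never compete.
  open PartialAssignment (partialAssignment (λ p q → L p (suc q) × ¬ L p zero) (λ p q → L? p (suc q) ×-dec ¬? (L? p zero)))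
  to′ : Fin a → Maybe (Fin (suc b))
  to′ p with L? p zero
  ... | yes _ = just zero
  ... | no  _ = Maybe.map suc (to p)
  to-zero : ∀ {p} → L p zero → to′ p ≡ just zero
  to-zero {p} l with L? p zero
  ... | yes _  = refl
  ... | no  ¬l = contradiction l ¬l
  to-suc : ∀ {p q} → to p ≡ just q → to′ p ≡ just (suc q)
  to-suc {p} e with L? p zero
  ... | yes l = contradiction l (proj₂ (sound e))
  ... | no  _ = cong (Maybe.map suc) e
  sound′ : ∀ {p q} → to′ p ≡ just q → L p q
  sound′ {p} e with L? p zero
  sound′ {p} refl | yes l = l
  sound′ {p} e | no _ with to p in eq
  sound′ {p} refl | no _ | just q = proj₁ (sound eq)
  shared′ : ∀ {p q} → to′ p ≡ just q → ∃ λ p′ → p′ ≢ p × to′ p′ ≡ just q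
  shared′ {p} e with L? p zero
  shared′ {p} refl | yes l with p₁ ≟ p
  ... | yes p₁≡p = p₂ , (λ e → p₂≢p₁ (trans e (≡-sym p₁≡p))) , to-zero l₂
  ... | no  p₁≢p = p₁ , p₁≢p , to-zero l₁
  shared′ {p} e | no _ with to p in eq
  shared′ {p} refl | no _ | just q = let p′ , ne , e′ = shared eq in p′ , ne , to-suc e′
  unassigned : ∀ {p} → to′ p ≡ nothing → ¬ L p zero × to p ≡ nothing
  unassigned {p} e with L? p zero
  ... | no ¬l with to p
  ...   | nothing = ¬l , refl
  unique′ : ∀ {p p′ q} → L p q → L p′ q → to′ p ≡ nothing → to′ p′ ≡ nothing → p ≡ p′
  unique′ {q = zero}  l l′ e e′ = contradiction l (proj₁ (unassigned e))
  unique′ {q = suc q} l l′ e e′ =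
    let ¬z , f = unassigned e ; ¬z′ , f′ = unassigned e′ in unique (l , ¬z) (l′ , ¬z′) f f′

-- Weights 1 and 2 with sum 0 modulo 3.

weighted : (Fin n → Bool) → (Fin n → Fin 3) → ℕ
weighted b w = sum (λ y → if b y then weightVal (w y) else 0)

extend : Fin 3 → (Fin n → Fin 3) → Fin (suc n) → Fin 3
extend h w zero    = h
extend h w (suc y) = w y

extend-nonzero : ∀ {h} {w : Fin n → Fin 3} → ¬ 3 ∣ weightVal h → (∀ y → ¬ 3 ∣ weightVal (w y)) →
                 ∀ y → ¬ 3 ∣ weightVal (extend h w y)
extend-nonzero p q zero    = p
extend-nonzero p q (suc y) = q y

-- All weights but the last keep the running sum nonzero, so that `complete3` can finish with a
-- weight 1 or 2.
cancelAll : (b : Fin n → Bool) → (∃ λ y → b y ≡ true) → ∀ s → ¬ 3 ∣ s →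
            ∃ λ (w : Fin n → Fin 3) → (∀ y → ¬ 3 ∣ weightVal (w y)) × 3 ∣ s + weighted b w
cancelAll {suc n} b (y , by) s ¬d = go (b zero) refl
  where
  tail : Fin n → Bool
  tail = b ∘ suc
  tail-nonempty : ∀ y → b y ≡ true → b zero ≡ false → ∃ λ y → tail y ≡ true
  tail-nonempty zero    e eq = case trans (≡-sym eq) e of λ ()
  tail-nonempty (suc y) e eq = y , e
  go : ∀ c → b zero ≡ c → ∃ λ (w : Fin (suc n) → Fin 3) → (∀ y → ¬ 3 ∣ weightVal (w y)) × 3 ∣ s + weighted b w
  go false eq =
    let w , p , q = cancelAll tail (tail-nonempty y by eq) s ¬d in
    extend 0F w , extend-nonzero (from-no (3 ∣? 1)) p ,
    subst (λ c → 3 ∣ s + ((if c then 1 else 0) + weighted tail w)) (≡-sym eq) q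
  go true eq with any? (λ y → tail y Bool.≟ true)
  ... | yes more =
    -- The argument 0 excludes weight 3, the argument `s` keeps the running sum nonzero.
    let h , nz , s+h = avoidTwo 0 s
        w , p , q = cancelAll tail more (s + weightVal h) s+h in
    extend h w , extend-nonzero nz p ,
    subst (λ c → 3 ∣ s + ((if c then weightVal h else 0) + weighted tail w)) (≡-sym eq)
      (subst (3 ∣_) (+-assoc s (weightVal h) _) q)
  ... | no none =
    let h , nz , s+h = complete3 s ¬d in
    extend h (λ _ → 0F) , extend-nonzero nz (λ _ → from-no (3 ∣? 1)) ,
    subst₂ (λ c r → 3 ∣ s + ((if c then weightVal h else 0) + r)) (≡-sym eq)
      (≡-sym (sum-zero {n} _ λ y → cong 𝟙 (empty y)))
      (subst (λ r → 3 ∣ s + r) (≡-sym (+-identityʳ _)) s+h)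
    where
    empty : ∀ y → tail y ≡ false
    empty y with tail y in e
    ... | true  = contradiction (y , e) none
    ... | false = refl

-- A nonempty set has at least two elements here: the first gets weight 1 and the others cancel it.
cancelPair : (b : Fin n → Bool) → (∀ y → b y ≡ true → ∃ λ y′ → y′ ≢ y × b y′ ≡ true) →
             ∃ λ (w : Fin n → Fin 3) → (∀ y → ¬ 3 ∣ weightVal (w y)) × 3 ∣ weighted b w
cancelPair {zero} b two = (λ ()) , (λ ()) , 3 ∣0
cancelPair {suc n} b two = go (b zero) refl
  where
  go : ∀ c → b zero ≡ c → ∃ λ (w : Fin (suc n) → Fin 3) → (∀ y → ¬ 3 ∣ weightVal (w y)) × 3 ∣ weighted b w
  go true eq =
    let w , p , q = cancelAll (b ∘ suc) (more (two zero eq)) 1 (from-no (3 ∣? 1)) in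
    extend 0F w , extend-nonzero (from-no (3 ∣? 1)) p ,
    subst (λ c → 3 ∣ (if c then 1 else 0) + weighted (b ∘ suc) w) (≡-sym eq) q
    where
    more : (∃ λ y′ → y′ ≢ zero × b y′ ≡ true) → ∃ λ y → b (suc y) ≡ true
    more (zero  , ne , _) = contradiction refl ne
    more (suc y , _  , e) = y , e
  go false eq =
    let w , p , q = cancelPair (b ∘ suc) two′ in
    extend 0F w , extend-nonzero (from-no (3 ∣? 1)) p ,
    subst (λ c → 3 ∣ (if c then 1 else 0) + weighted (b ∘ suc) w) (≡-sym eq) q
    where
    two′ : ∀ y → b (suc y) ≡ true → ∃ λ y′ → y′ ≢ y × b (suc y′) ≡ true
    two′ y by with two (suc y) by
    ... | zero   , _  , e = case trans (≡-sym eq) e of λ ()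
    ... | suc y′ , ne , e = y′ , ne ∘ cong suc , e

isJust? : ∀ {b} (x : Maybe (Fin b)) (q : Fin b) → Dec (x ≡ just q)
isJust? x q = Maybe-≡-dec _≟_ x (just q)

-- Distinct fibres of `m` are disjoint, so the weights that `cancelPair` finds for the single fibres
-- combine into one function.
fibreWeights : ∀ {a b} (m : Fin a → Maybe (Fin b)) →
  (∀ {p q} → m p ≡ just q → ∃ λ p′ → p′ ≢ p × m p′ ≡ just q) →
  ∃ λ (f : Fin a → Fin 3) → (∀ p → ¬ 3 ∣ weightVal (f p)) ×
          (∀ q → 3 ∣ sum (λ p → if does (isJust? (m p) q) then weightVal (f p) else 0))
fibreWeights {a} {b} m shared = f , nz , zero-sum
  where
  inFibre : Fin b → Fin a → Bool
  inFibre q p = does (isJust? (m p) q)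
  fibre : ∀ q → ∃ λ (w : Fin a → Fin 3) → (∀ p → ¬ 3 ∣ weightVal (w p)) × 3 ∣ weighted (inFibre q) w
  fibre q = cancelPair (inFibre q) two
    where
    two : ∀ p → inFibre q p ≡ true → ∃ λ p′ → p′ ≢ p × inFibre q p′ ≡ true
    two p e with isJust? (m p) q
    ... | yes e′ = let p′ , ne , e″ = shared e′ in p′ , ne , dec-true (isJust? (m p′) q) e″
  pick : Fin a → Maybe (Fin b) → Fin 3
  pick p (just q) = proj₁ (fibre q) p
  -- Unassigned tails lie in no fibre; weight 1 just satisfies `nz`.
  pick p nothing  = 0F
  f : Fin a → Fin 3
  f p = pick p (m p)
  nz : ∀ p → ¬ 3 ∣ weightVal (f p)
  nz p with m p
  ... | just q  = proj₁ (proj₂ (fibre q)) p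
  ... | nothing = from-no (3 ∣? 1)
  zero-sum : ∀ q → 3 ∣ weighted (inFibre q) f
  zero-sum q = subst (3 ∣_) (sum-cong-≗ same) (proj₂ (proj₂ (fibre q)))
    where
    same : ∀ p → (if inFibre q p then weightVal (proj₁ (fibre q) p) else 0)
               ≡ (if inFibre q p then weightVal (f p) else 0)
    same p with isJust? (m p) q
    ... | yes e = cong (λ x → weightVal (pick p x)) (≡-sym e)
    ... | no  _ = refl

-- The cyclic orientation and the selected edges.

next-≢ : ∀ {a} → next a ≢ a
next-≢ {0F} ()
next-≢ {1F} ()
next-≢ {2F} ()

next²-≢ : ∀ {a} → next (next a) ≢ a
next²-≢ {0F} ()
next²-≢ {1F} ()
next²-≢ {2F} ()

next³ : ∀ a → next (next (next a)) ≡ a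
next³ 0F = refl
next³ 1F = refl
next³ 2F = refl

next-injective : ∀ {a b} → next a ≡ next b → a ≡ b
next-injective {a} {b} e = trans (≡-sym (next³ a)) (trans (cong (next ∘ next) e) (next³ b))

does-true : ∀ {P : Set} (p? : Dec P) → does p? ≡ true → P
does-true (yes p) _ = p

∧-true : ∀ {a b} → a ∧ b ≡ true → a ≡ true × b ≡ true
∧-true {true} e = refl , e

module Coloured {n} (G : Graph n) (col : Fin n → Fin 3) where

  Adj : Fin n → Fin n → Set
  Adj u v = adj G u v ≡ true

  Adj-sym : ∀ {u v} → Adj u v → Adj v u
  Adj-sym {u} {v} = trans (Graph.sym G v u)

  Adj? : ∀ u v → Dec (Adj u v)
  Adj? u v = adj G u v Bool.≟ true

  own : Fin n → Fin n → Bool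
  own u v = adj G u v ∧ does (col v ≟ col u)

  own-Adj : ∀ {u v} → own u v ≡ true → Adj u v × col v ≡ col u
  own-Adj {u} {v} e = let p , q = ∧-true e in p , does-true (col v ≟ col u) q

  own-true : ∀ {u v} → Adj u v → col v ≡ col u → own u v ≡ true
  own-true {u} {v} p q = cong₂ _∧_ p (dec-true (col v ≟ col u) q)

  own-sym : ∀ u v → own u v ≡ own v u
  own-sym u v = cong₂ _∧_ (Graph.sym G u v) (does-≟-sym (col v) (col u))

  own-irrefl : ∀ v → own v v ≡ false
  own-irrefl v rewrite irrefl G v = refl

  Active : Fin n → Set
  Active v = ∃ λ y → own v y ≡ true

  Active? : ∀ v → Dec (Active v)
  Active? v = any? λ y → own v y Bool.≟ true

  -- The edges between classes, oriented from `u` to `v`.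
  X : Fin n → Fin n → Set
  X u v = Adj u v × col v ≡ next (col u)

  X? : ∀ u v → Dec (X u v)
  X? u v = Adj? u v ×-dec (col v ≟ next (col u))

  X-asym : ∀ {u v} → X u v → ¬ X v u
  X-asym (_ , e) (_ , e′) = next²-≢ (≡-sym (trans e′ (cong next e)))

  -- The edge itself is not demanded; together with `Adj u v` this means that `u` has degree 1.
  Lone : Fin n → Fin n → Set
  Lone u v = ∀ y → Adj u y → y ≡ v

  Lone? : ∀ u v → Dec (Lone u v)
  Lone? u v = all? λ y → Adj? u y →-dec (y ≟ v)

  Leaf : Fin n → Fin n → Set
  Leaf a y = X y a × Lone y a

  Leaf? : ∀ a y → Dec (Leaf a y)
  Leaf? a y = X? y a ×-dec Lone? y a

  Lone⇒degree1 : ∀ {u v} → Adj u v → Lone u v → degree G u ≡ 1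
  Lone⇒degree1 {u} {v} uv lone = trans (Σv≡sum (λ y → 𝟙 (adj G y u))) (trans
    (sum-single (λ y → 𝟙 (adj G y u)) v away) (cong 𝟙 (Adj-sym uv)))
    where
    away : ∀ y → y ≢ v → 𝟙 (adj G y u) ≡ 0
    away y y≢v with adj G y u in e
    ... | true  = contradiction (lone y (Adj-sym e)) y≢v
    ... | false = refl

  -- The hypothesis on isolated edges enters here: if `v` had no other neighbour, both ends would
  -- have degree 1.
  Lone⇒other : HasNoIsolatedEdge G → ∀ {u v} → Adj u v → Lone u v → ∃ λ y → y ≢ u × Adj v y
  Lone⇒other noIso {u} {v} uv lone with any? (λ y → ¬? (y ≟ u) ×-dec Adj? v y)
  ... | yes p = p
  ... | no ¬p = contradiction
    (Lone⇒degree1 uv lone , Lone⇒degree1 (Adj-sym uv) lone′) (noIso u v uv)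
    where
    lone′ : Lone v u
    lone′ y vy with y ≟ u
    ... | yes e = e
    ... | no ne = contradiction (y , ne , vy) ¬p

  -- The edges that may join the part of class col a with weight 3 in order to tune the sum of a.
  Candidate : Fin n → Fin n → Set
  Candidate a y = Active a × (X a y ⊎ Leaf a y)

  Candidate? : ∀ a y → Dec (Candidate a y)
  Candidate? a y = Active? a ×-dec (X? a y ⊎-dec Leaf? a y)

  candidate : Fin n → Fin n → Bool
  candidate a y = does (Candidate? a y)

  HasLeaf : Fin n → Set
  HasLeaf a = Active a × ∃ (Leaf a)

  HasLeaf? : ∀ a → Dec (HasLeaf a)
  HasLeaf? a = Active? a ×-dec any? (Leaf? a)

  slack : Fin n → Bool
  slack a = does (HasLeaf? a)

  record Selection : Set where
    field
      g                  : Fin n → Fin n → Fin 3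
      g-sym              : ∀ u v → g u v ≡ g v u
      sel                : Fin n → Fin n → Bool
      Active⇒predecessor : ∀ {u} → Active u → ∃ λ y → X y u

    base : Fin n → ℕ
    base u = sum (λ y → if own u y then weightVal (g u y) else 0)

    field
      base-nonzero      : ∀ {u} → Active u → ¬ 3 ∣ base u
      sel-Candidate     : ∀ {a y} → sel a y ≡ true → Candidate a y
      sel-distinguishes : ∀ {u v} → own u v ≡ true → base u + count (sel u) * 3 ≢ base v + count (sel v) * 3
      -- A leaf makes one more candidate than is needed to separate a from its neighbours, and this
      -- freedom is spent on not omitting a single candidate, which could be left isolated.
      omitted-twice     : ∀ {a y} → ∃ (Leaf a) → Candidate a y → sel a y ≡ false →
                          ∃ λ y′ → y′ ≢ y × Candidate a y′ × sel a y′ ≡ false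

  module Select (maximal : LocalMaxCut.LocallyMaximal G col) where

    open LocalMaxCut G using (nbrs)

    -- By local maximality an active vertex has at least as many out-neighbours as neighbours in its
    -- own class. A leaf is a further candidate, since it is an in-neighbour.
    enough : ∀ a → 𝟙 (slack a) + count (own a) ≤ count (candidate a)
    enough a = go (Active? a)
      where
      open ≤-Reasoning
      go : Dec (Active a) → 𝟙 (slack a) + count (own a) ≤ count (candidate a)
      go (no inactive) = begin
        𝟙 (slack a) + count (own a) ≡⟨ cong₂ _+_ (cong 𝟙 (dec-false (HasLeaf? a) (inactive ∘ proj₁))) none ⟩
        0 ≤⟨ z≤n ⟩
        count (candidate a) ∎
        where
        none : count (own a) ≡ 0
        none with count (own a) ℕ.≟ 0
        ... | yes e = e
        ... | no ne = contradiction (count-witness (own a) ne) inactive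
      go (yes act) = begin
        𝟙 (slack a) + count (own a) ≤⟨ +-mono-≤ leaves (maximal a (next (col a))) ⟩
        count (λ y → does (Leaf? a y)) + nbrs col a (next (col a)) ≡⟨ ∑-distrib-+ (λ y → 𝟙 (does (Leaf? a y))) _ ⟨
        sum (λ y → 𝟙 (does (Leaf? a y)) + 𝟙 (adj G a y ∧ does (col y ≟ next (col a)))) ≡⟨ sum-cong-≗ entry ⟩
        count (candidate a) ∎
        where
        leaves : 𝟙 (slack a) ≤ count (λ y → does (Leaf? a y))
        leaves = has (HasLeaf? a)
          where
          has : (d : Dec (HasLeaf a)) → 𝟙 (does d) ≤ count (λ y → does (Leaf? a y))
          has (no  _)           = z≤n
          has (yes (_ , y , l)) = count-pos _ {y} (dec-true (Leaf? a y) l)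
        X-bool : ∀ y → (adj G a y ∧ does (col y ≟ next (col a))) ≡ does (X? a y)
        X-bool y = cong (_∧ does (col y ≟ next (col a))) (≟true (adj G a y))
          where
          ≟true : ∀ b → b ≡ does (b Bool.≟ true)
          ≟true true  = refl
          ≟true false = refl
        entry : ∀ y → 𝟙 (does (Leaf? a y)) + 𝟙 (adj G a y ∧ does (col y ≟ next (col a))) ≡ 𝟙 (candidate a y)
        entry y = trans (cong (λ b → 𝟙 (does (Leaf? a y)) + 𝟙 b) (X-bool y)) (cases (Leaf? a y) (X? a y))
          where
          cases : Dec (Leaf a y) → Dec (X a y) → 𝟙 (does (Leaf? a y)) + 𝟙 (does (X? a y)) ≡ 𝟙 (candidate a y)
          cases (yes l) (yes x) = contradiction (proj₁ l) (X-asym x)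
          cases (yes l) (no ¬x) rewrite dec-true (Leaf? a y) l | dec-false (X? a y) ¬x
            | dec-true (Active? a) act = refl
          cases (no ¬l) (yes x) rewrite dec-false (Leaf? a y) ¬l | dec-true (X? a y) x
            | dec-true (Active? a) act = refl
          cases (no ¬l) (no ¬x) rewrite dec-false (Leaf? a y) ¬l | dec-false (X? a y) ¬x
            | dec-true (Active? a) act = refl

    open Σ (nonzeroWeights own own-sym own-irrefl) renaming (proj₁ to g; proj₂ to g-ok)

    base : Fin n → ℕ
    base u = sum (λ y → if own u y then weightVal (g u y) else 0)

    private
      -- `level` tells how many candidates to select at each vertex; `chosen` then picks that many.
      level = distinguish own own-sym own-irrefl base (count ∘ candidate) slack enough
      chosen = λ a → subset (candidate a) (proj₁ level a) (proj₁ (proj₂ level) a)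

    sel : Fin n → Fin n → Bool
    sel a = proj₁ (chosen a)

    sel-Candidate : ∀ {a y} → sel a y ≡ true → Candidate a y
    sel-Candidate {a} {y} s = does-true (Candidate? a y) (proj₁ (proj₂ (chosen a)) y s)

    base-nonzero : ∀ {u} → Active u → ¬ 3 ∣ base u
    base-nonzero (y , o) = proj₂ g-ok _ y o

    sel-distinguishes : ∀ {u v} → own u v ≡ true → base u + count (sel u) * 3 ≢ base v + count (sel v) * 3
    sel-distinguishes {u} {v} o e = proj₂ (proj₂ (proj₂ level)) u v o
      (subst₂ (λ s t → base u + s * 3 ≡ base v + t * 3) (proj₂ (proj₂ (chosen u))) (proj₂ (proj₂ (chosen v))) e)

    omitted-twice : ∀ {a y} → ∃ (Leaf a) → Candidate a y → sel a y ≡ false →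
                    ∃ λ y′ → y′ ≢ y × Candidate a y′ × sel a y′ ≡ false
    omitted-twice {a} {y} leaf cand s =
      let y′ , ne , c , s′ = another-omitted (candidate a) (sel a) (proj₁ (proj₂ (chosen a)))
            (subst (λ t → suc t ≢ count (candidate a)) (≡-sym (proj₂ (proj₂ (chosen a))))
              (proj₁ (proj₂ (proj₂ level)) a (dec-true (HasLeaf? a) (proj₁ cand , leaf))))
            (dec-true (Candidate? a y) cand) s
      in y′ , ne , does-true (Candidate? a y′) c , s′

    -- By local maximality a neighbour in the own class forces one in the preceding class, which is
    -- reached by `next` applied twice.
    Active⇒predecessor : ∀ {u} → Active u → ∃ λ y → X y u
    Active⇒predecessor {u} (z , o) =
      let y , e = count-witness (λ y → adj G u y ∧ does (col y ≟ next (next (col u)))) nonzero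
          p , q = ∧-true e
      in y , Adj-sym p , ≡-sym (trans (cong next (does-true (col y ≟ next (next (col u))) q)) (next³ (col u)))
      where
      nonzero : nbrs col u (next (next (col u))) ≢ 0
      nonzero e = contradiction (≤-trans (count-pos (own u) o)
        (subst (count (own u) ≤_) e (maximal u (next (next (col u)))))) λ ()

    selection : Selection
    selection = record
      { g = g ; g-sym = proj₁ g-ok ; sel = sel ; Active⇒predecessor = Active⇒predecessor
      ; base-nonzero = base-nonzero ; sel-Candidate = sel-Candidate
      ; sel-distinguishes = sel-distinguishes ; omitted-twice = omitted-twice }

-- The parts are indexed by a kind and a colour class: the edges inside a class with the selected
-- ones, the edges at assigned tails, the stars at unassigned tails, and the paths and cycles of
-- otherwise isolated edges, for which only class 0F is used.
pattern main   = 0F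
pattern assign = 1F
pattern stars  = 2F
pattern paths  = 3F

Kind : Set
Kind = Fin 8

-- Classification of the oriented edges and their labels.

module Labelling {n} (G : Graph n) (noIso : HasNoIsolatedEdge G) (col : Fin n → Fin 3)
                 (S : Coloured.Selection G col) where

  open Coloured G col
  open Selection S

  -- The remaining edges: selected neither from the tail nor, as leaf edges, from the head.
  L : Fin n → Fin n → Set
  L u v = X u v × sel u v ≡ false × sel v u ≡ false

  L? : ∀ u v → Dec (L u v)
  L? u v = X? u v ×-dec (sel u v Bool.≟ false) ×-dec (sel v u Bool.≟ false)

  -- A vertex counts separately as a tail and as a head; `M` consists of the edges isolated in the
  -- resulting bipartite graph.
  OutLone InLone M : Fin n → Fin n → Set
  OutLone p q = ∀ y → L p y → y ≡ q
  InLone  p q = ∀ y → L y q → y ≡ p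
  M p q = L p q × OutLone p q × InLone p q

  M? : ∀ p q → Dec (M p q)
  M? p q = L? p q ×-dec all? (λ y → L? p y →-dec (y ≟ q)) ×-dec all? (λ y → L? y q →-dec (y ≟ p))

  -- Another edge of `M` can meet `u → v` only by entering `u` or by leaving `v`, so `I` consists of
  -- the edges of `M` that touch no other one.
  I : Fin n → Fin n → Set
  I u v = M u v × ¬ (∃ λ y → M y u) × ¬ (∃ λ y → M v y)

  Active⇒¬Lone : ∀ {u v} → X u v → Active u → ¬ Lone u v
  Active⇒¬Lone (_ , e) (y , o) lone with own-Adj o
  ... | uy , same = next-≢ (trans (≡-sym e) (trans (cong col (≡-sym (lone y uy))) same))

  -- A head selects an edge only if its tail is a leaf, and a leaf has no neighbour in its own
  -- class, hence selects nothing itself.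
  sel-back : ∀ {u v} → X u v → sel v u ≡ true → Lone u v × Active v × sel u v ≡ false
  sel-back {u} {v} x s with sel-Candidate s
  ... | _   , inj₁ x′ = contradiction x′ (X-asym x)
  ... | act , inj₂ (_ , lone) = lone , act , none
    where
    none : sel u v ≡ false
    none with sel u v in e
    ... | false = refl
    ... | true  = contradiction lone (Active⇒¬Lone x (proj₁ (sel-Candidate e)))

  sel-X : ∀ {u v} → X u v → sel u v ≡ true → Active u
  sel-X x s = proj₁ (sel-Candidate s)

  cases-X : ∀ {u v} → X u v → sel u v ≡ true ⊎ sel v u ≡ true ⊎ L u v
  cases-X {u} {v} x with sel u v in e | sel v u in e′
  ... | true  | _     = inj₁ refl
  ... | false | true  = inj₂ (inj₁ refl)
  ... | false | false = inj₂ (inj₂ (x , refl , refl))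

  colours : ∀ x y → (col y ≡ col x) ⊎ (col y ≡ next (col x)) ⊎ (col x ≡ next (col y))
  colours x y = go (col x) (col y)
    where
    go : ∀ a b → (b ≡ a) ⊎ (b ≡ next a) ⊎ (a ≡ next b)
    go 0F 0F = inj₁ refl
    go 0F 1F = inj₂ (inj₁ refl)
    go 0F 2F = inj₂ (inj₂ refl)
    go 1F 0F = inj₂ (inj₂ refl)
    go 1F 1F = inj₁ refl
    go 1F 2F = inj₂ (inj₁ refl)
    go 2F 0F = inj₂ (inj₁ refl)
    go 2F 1F = inj₂ (inj₂ refl)
    go 2F 2F = inj₁ refl

  true≢false : ∀ {b} {A : Set} → b ≡ true → b ≡ false → A
  true≢false refl ()

  -- The last resort of `attached`. A vertex with a leaf never omits a single candidate; this makes
  -- first `u` and then `v` inactive. In between it follows that `u` has degree 1, and a second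
  -- neighbour of `v` supplies the selected edge.
  leaf-attachment : ∀ {u v} → I u v → ¬ (∃ λ y → L y u) → ¬ (∃ λ y → L v y) →
                    ¬ (∃ λ y → X y u × sel y u ≡ true) →
                    Lone u v × ∃ λ y → y ≢ u × X y v × sel y v ≡ true
  leaf-attachment {u} {v} ((l@(uv , s₁ , s₂) , out , inn) , _) noIn noOut noSel = lone , attach
    where
    no-predecessor : ∀ y → ¬ X y u
    no-predecessor y x with cases-X x
    ... | inj₁ s         = noSel (y , x , s)
    ... | inj₂ (inj₂ l′) = noIn (y , l′)
    ... | inj₂ (inj₁ s)  with sel-back x s
    -- Here `y` is a leaf of `u`, and `v` is an omitted candidate of `u`. Hence a second candidate
    -- `z` is omitted, and its edge fits none of the cases of `cases-X`.
    ...   | lone-y , act , _ with omitted-twice (y , x , lone-y) (act , inj₁ uv) s₁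
    no-predecessor y x | _ | _ | z , z≢v , (_ , inj₁ xz) , s with cases-X xz
    ... | inj₁ s′        = true≢false s′ s
    ... | inj₂ (inj₁ s′) = z≢v (≡-sym (proj₁ (sel-back xz s′) v (proj₁ uv)))
    ... | inj₂ (inj₂ l′) = z≢v (out z l′)
    no-predecessor y x | _ | _ | z , z≢v , (_ , inj₂ (xz , _)) , s with cases-X xz
    ... | inj₁ s′        = noSel (z , xz , s′)
    ... | inj₂ (inj₁ s′) = true≢false s′ s
    ... | inj₂ (inj₂ l′) = noIn (z , l′)

    inactive : ¬ Active u
    inactive act = let y , x = Active⇒predecessor act in no-predecessor y x

    lone : Lone u v
    lone y uy with colours u y
    ... | inj₁ same = contradiction (y , own-true uy same) inactive
    ... | inj₂ (inj₂ prev) = contradiction (Adj-sym uy , prev) (no-predecessor y)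
    ... | inj₂ (inj₁ nxt) with cases-X (uy , nxt)
    ...   | inj₁ s         = contradiction (sel-X (uy , nxt) s) inactive
    ...   | inj₂ (inj₁ s)  = ≡-sym (proj₁ (sel-back (uy , nxt) s) v (proj₁ uv))
    ...   | inj₂ (inj₂ l′) = out y l′

    inactive-head : ¬ Active v
    -- Now `u` is a leaf of `v` and at the same time an omitted candidate, so again a second one
    -- would be omitted.
    inactive-head act with omitted-twice (u , uv , lone) (act , inj₂ (uv , lone)) s₂
    inactive-head act | z , z≢u , (_ , inj₁ xz) , s with cases-X xz
    ... | inj₁ s′        = true≢false s′ s
    ... | inj₂ (inj₁ s′) = z≢u (≡-sym (proj₁ (sel-back xz s′) u (Adj-sym (proj₁ uv))))
    ... | inj₂ (inj₂ l′) = noOut (z , l′)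
    inactive-head act | z , z≢u , (_ , inj₂ (xz , lone-z)) , s with cases-X xz
    ... | inj₁ s′        = Active⇒¬Lone xz (sel-X xz s′) lone-z
    ... | inj₂ (inj₁ s′) = true≢false s′ s
    ... | inj₂ (inj₂ l′) = z≢u (inn z l′)

    attach : ∃ λ y → y ≢ u × X y v × sel y v ≡ true
    attach with Lone⇒other noIso (proj₁ uv) lone
    ... | y , y≢u , vy with colours v y
    ...   | inj₁ same = contradiction (y , own-true vy same) inactive-head
    ...   | inj₂ (inj₁ nxt) with cases-X (vy , nxt)
    ...     | inj₁ s         = contradiction (sel-X (vy , nxt) s) inactive-head
    ...     | inj₂ (inj₁ s)  = contradiction (≡-sym (proj₁ (sel-back (vy , nxt) s) u (Adj-sym (proj₁ uv)))) y≢u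
    ...     | inj₂ (inj₂ l′) = contradiction (y , l′) noOut
    attach | y , y≢u , vy | inj₂ (inj₂ prev) with cases-X (Adj-sym vy , prev)
    ...     | inj₁ s         = y , y≢u , (Adj-sym vy , prev) , s
    ...     | inj₂ (inj₁ s)  = contradiction (proj₁ (proj₂ (sel-back (Adj-sym vy , prev) s))) inactive-head
    ...     | inj₂ (inj₂ l′) = contradiction (inn y l′) y≢u

  module Labels (P : PartialAssignment L) (f : Fin n → Fin 3) where

    open PartialAssignment P

    Star : Fin n → Fin n → Set
    Star p q = L p q × to p ≡ nothing × ∃ λ q′ → q′ ≢ q × L p q′

    Pendant : Fin n → Fin n → Set
    Pendant p q = L p q × to p ≡ nothing × OutLone p q × ∃ λ p′ → p′ ≢ p × L p′ q

    Assigned : Fin n → Fin n → Set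
    Assigned p q = L p q × ∃ λ q′ → to p ≡ just q′

    -- An unassigned tail with a single head is an end of an edge of `M` unless that head has
    -- another tail.
    classify : ∀ {p q} → L p q → ¬ M p q → Assigned p q ⊎ Star p q ⊎ Pendant p q
    classify {p} {q} l ¬m with to p in e
    ... | just q′ = inj₁ (l , q′ , refl)
    ... | nothing with any? (λ y → ¬? (y ≟ q) ×-dec L? p y)
    ...   | yes other = inj₂ (inj₁ (l , refl , other))
    ...   | no  none  with any? (λ y → ¬? (y ≟ p) ×-dec L? y q)
    ...     | yes other = inj₂ (inj₂ (l , refl , outLone , other))
      where
      outLone : OutLone p q
      outLone y l′ with y ≟ q
      ... | yes y≡q = y≡q
      ... | no  y≢q = contradiction (y , y≢q , l′) none
    ...     | no  none′ = contradiction (l , outLone , inLone) ¬m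
      where
      outLone : OutLone p q
      outLone y l′ with y ≟ q
      ... | yes y≡q = y≡q
      ... | no  y≢q = contradiction (y , y≢q , l′) none
      inLone : InLone p q
      inLone y l′ with y ≟ p
      ... | yes y≡p = y≡p
      ... | no  y≢p = contradiction (y , y≢p , l′) none′

    -- The parts an oriented edge u → v may join, according to whether they belong to the
    -- colour class of u, that of v, or the third one. An edge attached at an unassigned tail gets
    -- weight 1, which moves the sum of that tail from 3 to 4 and away from the heads.
    data Home (u v : Fin n) : Kind → Fin 3 → Set where
      selected : sel u v ≡ true → Home u v main 2F
      hit      : L u v → to u ≡ just v → Home u v assign (f u)
      miss     : ∀ {q} → L u v → to u ≡ just q → q ≢ v → Home u v assign 2F
      pendant  : Pendant u v → Home u v assign 2F
      star     : Star u v → Home u v stars 2F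
      leaf     : ∀ {y} → I u v → Lone u v → y ≢ u → X y v → sel y v ≡ true → Home u v main 2F

    data Head (u v : Fin n) : Kind → Fin 3 → Set where
      back     : sel u v ≡ false → sel v u ≡ true → Head u v main 2F
      assigned : ∀ {y} → I u v → Assigned v y → Head u v assign 2F
      star     : ∀ {y} → I u v → Star v y → Head u v stars 0F
      pendant  : ∀ {y} → I u v → Pendant v y → Head u v assign 0F

    data Far (u v : Fin n) : Kind → Fin 3 → Set where
      selected : ∀ {y} → I u v → X y u → sel y u ≡ true → Far u v main 2F
      assigned : ∀ {y} → I u v → Assigned y u → Far u v assign 2F
      pendant  : ∀ {y} → I u v → Pendant y u → Far u v assign 2F
      -- Weight 1 leaves the head `u` of the star at a sum of at most 4, below the 6 that the centre
      -- reaches.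
      star     : ∀ {y} → I u v → Star y u → Far u v stars 0F

    data View (u v : Fin n) : Kind → Fin 3 → Fin 3 → Set where
      home    : ∀ {k j w} → j ≡ col u → Home u v k w → View u v k j w
      head    : ∀ {k j w} → j ≡ col v → Head u v k w → View u v k j w
      far     : ∀ {k j w} → j ≡ next (col v) → Far u v k w → View u v k j w
      matched : M u v → (∃ λ y → M y u) ⊎ (∃ λ y → M v y) → View u v paths 0F (col u)

    Label : Set
    Label = Kind × Fin 3 × Fin 3

    Labelled : Fin n → Fin n → Set
    Labelled u v = Σ Label λ (k , j , w) → View u v k j w

    -- Partners are sought in this order: a remaining edge leaving `v`, a remaining edge entering
    -- `u`, a selected edge entering `u`, a selected edge entering `v`. The first two are not in
    -- `M`, since `u → v` touches no other edge of `M`; so `classify` applies to them.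
    attached : ∀ {u v} → I u v → Labelled u v
    attached {u} {v} i@((_ , _) , noM-in , noM-out) with any? (λ y → L? v y)
    ... | yes (y , l) with classify l (λ m → noM-out (y , m))
    ...   | inj₁ a        = _ , head refl (assigned i a)
    ...   | inj₂ (inj₁ s) = _ , head refl (star i s)
    ...   | inj₂ (inj₂ p) = _ , head refl (pendant i p)
    attached {u} {v} i@((_ , _) , noM-in , noM-out) | no noOut with any? (λ y → L? y u)
    ... | yes (y , l) with classify l (λ m → noM-in (y , m))
    ...   | inj₁ a        = _ , far refl (assigned i a)
    ...   | inj₂ (inj₁ s) = _ , far refl (star i s)
    ...   | inj₂ (inj₂ p) = _ , far refl (pendant i p)
    attached {u} {v} i | no noOut | no noIn with any? (λ y → X? y u ×-dec (sel y u Bool.≟ true))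
    ... | yes (y , x , s) = _ , far refl (selected i x s)
    ... | no noSel with leaf-attachment i noIn noOut noSel
    ...   | lone , y , y≢u , x , s = _ , home refl (leaf i lone y≢u x s)

    labelled : ∀ {u v} → X u v → Labelled u v
    labelled {u} {v} x with cases-X x
    ... | inj₁ s        = _ , home refl (selected s)
    ... | inj₂ (inj₁ s) = _ , head refl (back (proj₂ (proj₂ (sel-back x s))) s)
    ... | inj₂ (inj₂ l) with M? u v
    ...   | yes m with any? (λ y → M? y u) | any? (λ y → M? v y)
    ...     | yes p | _     = _ , matched m (inj₁ p)
    ...     | no  _ | yes p = _ , matched m (inj₂ p)
    ...     | no ¬p | no ¬q = attached (m , ¬p , ¬q)
    labelled {u} {v} x | inj₂ (inj₂ l) | no ¬m with classify l ¬m
    ...     | inj₂ (inj₁ s) = _ , home refl (star s)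
    ...     | inj₂ (inj₂ p) = _ , home refl (pendant p)
    ...     | inj₁ (_ , q , e) with q ≟ v
    ...       | yes refl = _ , home refl (hit l e)
    ...       | no  q≢v  = _ , home refl (miss l e q≢v)

    -- Taken as a parameter by `Weights`, so that the verification sees only `view` and not the
    -- decisions made in `labelled`.
    record Labelling : Set where
      field
        lab  : Fin n → Fin n → Label
        view : ∀ {u v} → X u v → View u v (proj₁ (lab u v)) (proj₁ (proj₂ (lab u v))) (proj₂ (proj₂ (lab u v)))

    labelling : Labelling
    labelling = record { lab = lab ; view = view }
      where
      lab : Fin n → Fin n → Label
      lab u v with X? u v
      ... | yes x = proj₁ (labelled x)
      -- An arbitrary value: pairs outside `X` contribute nothing to `E`, and on non-edges the
      -- colouring is immaterial.
      ... | no  _ = main , 0F , 0F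
      view : ∀ {u v} → X u v → View u v (proj₁ (lab u v)) (proj₁ (proj₂ (lab u v))) (proj₂ (proj₂ (lab u v)))
      view {u} {v} x with X? u v
      ... | yes x′ = proj₂ (labelled x′)
      ... | no  ¬x = contradiction x ¬x

-- Contributions of the edges to the sums in each part.

weightVal≤3 : ∀ w → weightVal w ≤ 3
weightVal≤3 w = toℕ<n w

∤-sum : ∀ {n} (h : Fin n → ℕ) (v : Fin n) → ¬ 3 ∣ h v → (∀ y → y ≢ v → 3 ∣ h y) → ¬ 3 ∣ sum h
∤-sum {suc n} h v ¬d d ds = ¬d (∣m+n∣m⇒∣n (subst (3 ∣_) (trans (sum-remove {i = v} h) (+-comm (h v) _)) ds)
  (∣-sum _ λ y → d _ (punchInᵢ≢i v y)))

-- The truncated differences `h′ y ∸ h y` are genuine here, and all of them are divisible by 3.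
∣-sum-modified : ∀ {n} (h h′ : Fin n → ℕ) → 3 ∣ sum h → (∀ y → h′ y ≡ h y ⊎ (h y ≡ 0 × 3 ∣ h′ y)) → 3 ∣ sum h′
∣-sum-modified h h′ d rel = subst (3 ∣_) (trans (≡-sym (∑-distrib-+ h (λ y → h′ y ∸ h y))) (sum-cong-≗ (λ y → recombine y (rel y))))
  (∣m∣n⇒∣m+n d (∣-sum _ λ y → difference y (rel y)))
  where
  recombine : ∀ y → h′ y ≡ h y ⊎ (h y ≡ 0 × 3 ∣ h′ y) → h y + (h′ y ∸ h y) ≡ h′ y
  recombine y (inj₁ e)       rewrite e | n∸n≡0 (h y) = +-identityʳ _
  recombine y (inj₂ (e , _)) rewrite e = refl
  difference : ∀ y → h′ y ≡ h y ⊎ (h y ≡ 0 × 3 ∣ h′ y) → 3 ∣ h′ y ∸ h y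
  difference y (inj₁ e)       rewrite e | n∸n≡0 (h y) = 3 ∣0
  difference y (inj₂ (e , q)) rewrite e = q

module Verification {n} (G : Graph n) (noIso : HasNoIsolatedEdge G) (col : Fin n → Fin 3)
                    (S : Coloured.Selection G col)
                    (P : PartialAssignment (Labelling.L G noIso col S)) where

  open Coloured G col
  open Selection S
  open Labelling G noIso col S
  open PartialAssignment P

  module Weights
    (f : Fin n → Fin 3) (f-nonzero : ∀ p → ¬ 3 ∣ weightVal (f p))
    (f-fibre : ∀ q → 3 ∣ sum (λ p → if does (isJust? (to p) q) then weightVal (f p) else 0))
    (Λ : Labels.Labelling P f) where

    open Labels P f
    open Labels.Labelling Λ

    -- The 24 parts are the pairs of one of 8 kinds and one of 3 classes; `combine` is injective, so
    -- edges of the same part agree in both.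
    enc : Kind → Fin 3 → Fin 24
    enc = combine {8} {3}

    pay : Label → Kind → Fin 3 → ℕ
    pay (k′ , j′ , w) k j = if does (enc k′ j′ ≟ enc k j) then weightVal w else 0

    pay-same : ∀ k j w → pay (k , j , w) k j ≡ weightVal w
    pay-same k j w rewrite dec-true (enc k j ≟ enc k j) refl = refl

    pay-other : ∀ {k j k′ j′ w} → ¬ (k′ ≡ k × j′ ≡ j) → pay (k′ , j′ , w) k j ≡ 0
    pay-other {k} {j} {k′} {j′} ne rewrite dec-false (enc k′ j′ ≟ enc k j) (ne ∘ combine-injective k′ j′ k j) = refl

    E : Kind → Fin 3 → Fin n → Fin n → ℕ
    E k j u v = if does (X? u v) then pay (lab u v) k j else 0

    E-X : ∀ {k j u v} → X u v → E k j u v ≡ pay (lab u v) k j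
    E-X {k} {j} {u} {v} x rewrite dec-true (X? u v) x = refl

    E-¬X : ∀ {k j u v} → ¬ X u v → E k j u v ≡ 0
    E-¬X {k} {j} {u} {v} ¬x rewrite dec-false (X? u v) ¬x = refl

    -- Matching on `E k j u v` together with `contribution k j u v` replaces the nested conditionals
    -- by the cases of `View`.
    data Contribution (k : Kind) (j : Fin 3) (u v : Fin n) : ℕ → Set where
      none : Contribution k j u v 0
      some : ∀ {w} → X u v → View u v k j w → Contribution k j u v (weightVal w)

    contribution : ∀ k j u v → Contribution k j u v (E k j u v)
    contribution k j u v = edge (X? u v)
      where
      paid : ∀ {k′ j′ w} → X u v → View u v k′ j′ w → (d : Dec (enc k′ j′ ≡ enc k j)) →
             Contribution k j u v (if does d then weightVal w else 0)
      paid x vw (no  _) = none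
      paid {k′} {j′} x vw (yes e) with combine-injective k′ j′ k j e
      ... | refl , refl = some x vw
      edge : (d : Dec (X u v)) → Contribution k j u v (if does d then pay (lab u v) k j else 0)
      edge (no  _) = none
      edge (yes x) = paid x (view x) (enc (proj₁ (lab u v)) (proj₁ (proj₂ (lab u v))) ≟ enc k j)

    labelled-as : ∀ {u v} → X u v → ∃ λ k → ∃ λ j → ∃ λ w → View u v k j w × E k j u v ≡ weightVal w
    labelled-as {u} {v} x =
      let k , j , w = lab u v in k , j , w , view x , trans (E-X {k} {j} {u} {v} x) (pay-same k j w)

    O : Kind → Fin 3 → Fin n → Fin n → ℕ
    O k j x y = if own x y then pay (main , col x , g x y) k j else 0

    O-zero : ∀ {k j x} → ¬ (main ≡ k × col x ≡ j) → ∀ y → O k j x y ≡ 0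
    O-zero {x = x} ne y with own x y
    ... | true  = pay-other ne
    ... | false = refl

    -- The three terms stand for an edge inside the class, an edge leaving `x` and an edge entering
    -- `x`; at most one of them is nonzero.
    con : Kind → Fin 3 → Fin n → Fin n → ℕ
    con k j x y = O k j x y + (E k j x y + E k j y x)

    W : Kind → Fin 3 → Fin n → ℕ
    W k j x = sum (con k j x)

    W-split : ∀ k j x → W k j x ≡ sum (O k j x) + (sum (E k j x) + sum (λ y → E k j y x))
    W-split k j x = trans (∑-distrib-+ (O k j x) _) (cong (sum (O k j x) +_) (∑-distrib-+ (E k j x) _))

    W-foreign : ∀ {k j x} → ¬ (main ≡ k × col x ≡ j) → W k j x ≡ sum (E k j x) + sum (λ y → E k j y x)
    W-foreign {k} {j} {x} ne = trans (W-split k j x) 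
      (cong (_+ (sum (E k j x) + sum (λ y → E k j y x))) (sum-zero (O k j x) (O-zero ne)))

    E≤con-out : ∀ k j x y → E k j x y ≤ con k j x y
    E≤con-out k j x y = ≤-trans (m≤m+n _ _) (m≤n+m _ (O k j x y))

    E≤con-in : ∀ k j x y → E k j y x ≤ con k j x y
    E≤con-in k j x y = ≤-trans (m≤n+m _ (E k j x y)) (m≤n+m _ (O k j x y))

    W≥-out : ∀ k j x y → E k j x y ≤ W k j x
    W≥-out k j x y = ≤-trans (E≤con-out k j x y) (member≤sum (con k j x) y)

    W≥-in : ∀ k j x y → E k j y x ≤ W k j x
    W≥-in k j x y = ≤-trans (E≤con-in k j x y) (member≤sum (con k j x) y)

    W≥-out-out : ∀ k j x {y z} → y ≢ z → E k j x y + E k j x z ≤ W k j x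
    W≥-out-out k j x {y} {z} y≢z = ≤-trans (+-mono-≤ (E≤con-out k j x y) (E≤con-out k j x z)) (two-members≤sum (con k j x) y≢z)

    W≥-in-in : ∀ k j x {y z} → y ≢ z → E k j y x + E k j z x ≤ W k j x
    W≥-in-in k j x {y} {z} y≢z = ≤-trans (+-mono-≤ (E≤con-in k j x y) (E≤con-in k j x z)) (two-members≤sum (con k j x) y≢z)

    W≥-out-in : ∀ k j x {y z} → y ≢ z → E k j x y + E k j z x ≤ W k j x
    W≥-out-in k j x {y} {z} y≢z = ≤-trans (+-mono-≤ (E≤con-out k j x y) (E≤con-in k j x z)) (two-members≤sum (con k j x) y≢z)

    -- This and the next five lemmas: the direction of an edge at `x` and the position of the class
    -- of `x` relative to `j` decide between `Home`, `Head` and `Far`, because the other two would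
    -- give `j` a different value. The kind `paths` is excluded, as its class does not depend on the
    -- edge.
    out-home : ∀ {x y k j w} → k ≢ paths → j ≡ col x → X x y → View x y k j w → Home x y k w
    out-home k≢ e x (home _ h)    = h
    out-home k≢ e x (head e′ _)   = contradiction (trans (≡-sym (proj₂ x)) (trans (≡-sym e′) e)) next-≢
    out-home k≢ e x (far e′ _)    = contradiction (trans (cong next (≡-sym (proj₂ x))) (trans (≡-sym e′) e)) next²-≢
    out-home k≢ e x (matched _ _) = contradiction refl k≢

    in-head : ∀ {x y k j w} → k ≢ paths → j ≡ col x → X y x → View y x k j w → Head y x k w
    in-head k≢ e x (home e′ _)   = contradiction (trans (≡-sym (proj₂ x)) (trans (≡-sym e) e′)) next-≢
    in-head k≢ e x (head _ h)    = h
    in-head k≢ e x (far e′ _)    = contradiction (trans (≡-sym e′) e) next-≢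
    in-head k≢ e x (matched _ _) = contradiction refl k≢

    out-far : ∀ {x y k j w} → k ≢ paths → col x ≡ next j → X x y → View x y k j w → Far x y k w
    out-far k≢ e x (home e′ _)   = contradiction (trans (≡-sym e) (≡-sym e′)) next-≢
    out-far k≢ e x (head e′ _)   = contradiction (trans (cong next (≡-sym e)) (trans (≡-sym (proj₂ x)) (≡-sym e′))) next²-≢
    out-far k≢ e x (far _ h)     = h
    out-far k≢ e x (matched _ _) = contradiction refl k≢

    in-home : ∀ {x y k j w} → k ≢ paths → col x ≡ next j → X y x → View y x k j w → Home y x k w
    in-home k≢ e x (home _ h)    = h
    in-home k≢ e x (head e′ _)   = contradiction (trans (≡-sym e) (≡-sym e′)) next-≢
    in-home k≢ e x (far e′ _)    = contradiction (trans (cong next (≡-sym e)) (≡-sym e′)) next²-≢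
    in-home k≢ e x (matched _ _) = contradiction refl k≢

    out-head : ∀ {x y k j w} → k ≢ paths → j ≡ next (col x) → X x y → View x y k j w → Head x y k w
    out-head k≢ e x (home e′ _)   = contradiction (trans (≡-sym e) e′) next-≢
    out-head k≢ e x (head _ h)    = h
    out-head k≢ e x (far e′ _)    = contradiction (trans (cong next (≡-sym (proj₂ x))) (trans (≡-sym e′) e)) next-≢
    out-head k≢ e x (matched _ _) = contradiction refl k≢

    in-far : ∀ {x y k j w} → k ≢ paths → j ≡ next (col x) → X y x → View y x k j w → Far y x k w
    in-far k≢ e x (home e′ _)   = contradiction (trans (cong next (≡-sym (proj₂ x))) (trans (≡-sym e) e′)) next²-≢
    in-far k≢ e x (head e′ _)   = contradiction (trans (≡-sym e) e′) next-≢
    in-far k≢ e x (far _ h)     = h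
    in-far k≢ e x (matched _ _) = contradiction refl k≢

    far-I : ∀ {u v k w} → Far u v k w → I u v
    far-I (selected i _ _) = i
    far-I (assigned i _)   = i
    far-I (pendant i _)    = i
    far-I (star i _)       = i

    -- `p` could only be assigned to its single head `q`, but by `shared` another tail would then
    -- reach `q` too.
    matched-unassigned : ∀ {p q q′} → M p q → to p ≢ just q′
    matched-unassigned {p} {q} (_ , out , inn) e with out _ (sound e)
    ... | refl = let p′ , p′≢p , e′ = shared e in p′≢p (inn p′ (sound e′))

    -- Every other view concerns an edge of `M` or one selected from its head.
    home-of : ∀ {u v k j w} → L u v → ¬ M u v → View u v k j w → j ≡ col u × Home u v k w
    home-of l ¬m (home e h)               = e , h
    home-of l ¬m (head _ (back _ s))      = true≢false s (proj₂ (proj₂ l))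
    home-of l ¬m (head _ (assigned i _))  = contradiction (proj₁ i) ¬m
    home-of l ¬m (head _ (star i _))      = contradiction (proj₁ i) ¬m
    home-of l ¬m (head _ (pendant i _))   = contradiction (proj₁ i) ¬m
    home-of l ¬m (far _ h)                = contradiction (proj₁ (far-I h)) ¬m
    home-of l ¬m (matched m _)            = contradiction m ¬m

    just≢nothing : ∀ {p q} {A : Set} → to p ≡ just q → to p ≡ nothing → A
    just≢nothing e e′ = case trans (≡-sym e) e′ of λ ()

    E-hit : ∀ {p q} → to p ≡ just q → E assign (col p) p q ≡ weightVal (f p)
    E-hit {p} {q} e with labelled-as (proj₁ (sound e))
    ... | k , j , w , vw , eq with home-of (sound e) (λ m → matched-unassigned m e) vw
    ...   | refl , hit _ _               = eq
    ...   | refl , selected s            = true≢false s (proj₁ (proj₂ (sound e)))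
    ...   | refl , miss _ e′ q≢          = contradiction (just-injective (trans (≡-sym e′) e)) q≢
    ...   | refl , pendant (_ , e′ , _)  = just≢nothing e e′
    ...   | refl , star (_ , e′ , _)     = just≢nothing e e′
    ...   | refl , leaf i _ _ _ _        = contradiction e (matched-unassigned (proj₁ i))

    E-assigned : ∀ {p q} → Assigned p q → 1 ≤ E assign (col p) p q
    E-assigned {p} {q} (l , q′ , e) with labelled-as (proj₁ l)
    ... | k , j , w , vw , eq with home-of l (λ m → matched-unassigned m e) vw
    ...   | refl , hit _ _               = subst (1 ≤_) (≡-sym eq) (s≤s z≤n)
    ...   | refl , miss _ _ _            = subst (1 ≤_) (≡-sym eq) (s≤s z≤n)
    ...   | refl , selected s            = true≢false s (proj₁ (proj₂ l))
    ...   | refl , pendant (_ , e′ , _)  = just≢nothing e e′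
    ...   | refl , star (_ , e′ , _)     = just≢nothing e e′
    ...   | refl , leaf i _ _ _ _        = contradiction e (matched-unassigned (proj₁ i))

    E-pendant : ∀ {p q} → Pendant p q → E assign (col p) p q ≡ 3
    E-pendant {p} {q} (l , un , out , p′ , p′≢p , l′) with labelled-as (proj₁ l)
    ... | k , j , w , vw , eq with home-of l (λ m → p′≢p (proj₂ (proj₂ m) p′ l′)) vw
    ...   | refl , pendant _                   = eq
    ...   | refl , hit _ e                     = just≢nothing e un
    ...   | refl , miss _ e _                  = just≢nothing e un
    ...   | refl , selected s                  = true≢false s (proj₁ (proj₂ l))
    ...   | refl , star (_ , _ , q′ , q′≢ , m) = contradiction (out q′ m) q′≢
    ...   | refl , leaf i _ _ _ _              = contradiction (proj₂ (proj₂ (proj₁ i)) p′ l′) p′≢p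

    E-star : ∀ {p q} → Star p q → E stars (col p) p q ≡ 3
    E-star {p} {q} (l , un , q′ , q′≢q , l′) with labelled-as (proj₁ l)
    ... | k , j , w , vw , eq with home-of l (λ m → q′≢q (proj₁ (proj₂ m) q′ l′)) vw
    ...   | refl , star _                    = eq
    ...   | refl , hit _ e                   = just≢nothing e un
    ...   | refl , miss _ e _                = just≢nothing e un
    ...   | refl , selected s                = true≢false s (proj₁ (proj₂ l))
    ...   | refl , pendant (_ , _ , out , _) = contradiction (out q′ l′) q′≢q
    ...   | refl , leaf i _ _ _ _            = contradiction (proj₁ (proj₂ (proj₁ i)) q′ l′) q′≢q

    -- A pendant vertex lies in the third colour class of the part its isolated edge is attached to,
    -- where it meets nothing else.
    third-out : ∀ {u v} k → k ≢ paths → I u v → W k (col v) u ≡ E k (col v) u v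
    third-out {u} {v} k k≢ i@(((x , _) , out , _) , noIn , _) = begin
      W k (col v) u ≡⟨ W-foreign {k} {col v} {u} (λ (_ , e) → next-≢ (trans (≡-sym (proj₂ x)) (≡-sym e))) ⟩
      sum (E k (col v) u) + sum (λ y → E k (col v) y u) ≡⟨ cong₂ _+_ (sum-single _ v away) (sum-zero _ incoming) ⟩
      E k (col v) u v + 0 ≡⟨ +-identityʳ _ ⟩
      E k (col v) u v ∎
      where
      open ≡-Reasoning
      away : ∀ y → y ≢ v → E k (col v) u y ≡ 0
      away y y≢v with E k (col v) u y | contribution k (col v) u y
      ... | _ | none = refl
      ... | _ | some x′ vw with out-head k≢ (proj₂ x) x′ vw
      ...   | back _ s       = contradiction (≡-sym (proj₁ (sel-back x′ s) v (proj₁ x))) y≢v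
      ...   | assigned i′ _  = contradiction (out y (proj₁ (proj₁ i′))) y≢v
      ...   | star i′ _      = contradiction (out y (proj₁ (proj₁ i′))) y≢v
      ...   | pendant i′ _   = contradiction (out y (proj₁ (proj₁ i′))) y≢v
      incoming : ∀ y → E k (col v) y u ≡ 0
      incoming y with E k (col v) y u | contribution k (col v) y u
      ... | _ | none = refl
      ... | _ | some x′ vw = contradiction (y , proj₁ (far-I (in-far k≢ (proj₂ x) x′ vw))) noIn

    third-in : ∀ {u v} k → k ≢ paths → I u v → W k (next (col v)) v ≡ E k (next (col v)) u v
    third-in {u} {v} k k≢ i@(((x , _) , out , inn) , _ , noOut) = begin
      W k j v ≡⟨ W-foreign {k} {j} {v} (λ (_ , e) → next-≢ (≡-sym e)) ⟩
      sum (E k j v) + sum (λ y → E k j y v) ≡⟨ cong₂ _+_ (sum-zero _ outgoing) (sum-single _ u away) ⟩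
      E k j u v ∎
      where
      open ≡-Reasoning
      j = next (col v)
      away : ∀ y → y ≢ u → E k j y v ≡ 0
      away y y≢u with E k j y v | contribution k j y v
      ... | _ | none = refl
      ... | _ | some x′ vw = contradiction (inn y (proj₁ (proj₁ (far-I (in-far k≢ refl x′ vw))))) y≢u
      outgoing : ∀ y → E k j v y ≡ 0
      outgoing y with E k j v y | contribution k j v y
      ... | _ | none = refl
      ... | _ | some x′ vw with out-head k≢ refl x′ vw
      ...   | back _ s with proj₁ (sel-back x′ s) u (Adj-sym (proj₁ x))
      ...     | refl = contradiction x′ (X-asym x)
      outgoing y | _ | some x′ vw | assigned i′ _ = contradiction (y , proj₁ i′) noOut
      outgoing y | _ | some x′ vw | star i′ _     = contradiction (y , proj₁ i′) noOut
      outgoing y | _ | some x′ vw | pendant i′ _  = contradiction (y , proj₁ i′) noOut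

    contributes : ∀ k j u v → E k j u v ≢ 0 → ∃ λ w → X u v × View u v k j w
    contributes k j u v ne with E k j u v | contribution k j u v
    ... | _ | none      = contradiction refl ne
    ... | _ | some x vw = _ , x , vw

    E≤3 : ∀ k j u v → E k j u v ≤ 3
    E≤3 k j u v with E k j u v | contribution k j u v
    ... | _ | none         = z≤n
    ... | _ | some {w} _ _ = weightVal≤3 w

    same-tail-colour : ∀ {u u′ v} → X u v → X u′ v → col u ≡ col u′
    same-tail-colour x x′ = next-injective (trans (≡-sym (proj₂ x)) (proj₂ x′))

    third-colour : ∀ {y u v} → X y u → X u v → col y ≡ next (col v)
    third-colour {y} xy x = trans (≡-sym (next³ (col y)))
      (trans (cong (next ∘ next) (≡-sym (proj₂ xy))) (cong next (≡-sym (proj₂ x))))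

    X-chain-≢ : ∀ {y u v} → X y u → X u v → y ≢ v
    X-chain-≢ xy x refl = X-asym x xy

    not-main : ∀ {k : Kind} {A : Set} → main ≢ k → ¬ (main ≡ k × A)
    not-main ne (e , _) = ne e

    E-selected : ∀ {u v} → X u v → sel u v ≡ true → E main (col u) u v ≡ 3
    E-selected {u} {v} x s with labelled-as x
    ... | _ , _ , _ , home refl (selected _) , e        = e
    ... | _ , _ , _ , home refl (hit l _) , _           = true≢false s (proj₁ (proj₂ l))
    ... | _ , _ , _ , home refl (miss l _ _) , _        = true≢false s (proj₁ (proj₂ l))
    ... | _ , _ , _ , home refl (pendant (l , _)) , _   = true≢false s (proj₁ (proj₂ l))
    ... | _ , _ , _ , home refl (star (l , _)) , _      = true≢false s (proj₁ (proj₂ l))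
    ... | _ , _ , _ , home refl (leaf i _ _ _ _) , _    = true≢false s (proj₁ (proj₂ (proj₁ (proj₁ i))))
    ... | _ , _ , _ , head refl (back s′ _) , _         = true≢false s s′
    ... | _ , _ , _ , head refl (assigned i _) , _      = true≢false s (proj₁ (proj₂ (proj₁ (proj₁ i))))
    ... | _ , _ , _ , head refl (star i _) , _          = true≢false s (proj₁ (proj₂ (proj₁ (proj₁ i))))
    ... | _ , _ , _ , head refl (pendant i _) , _       = true≢false s (proj₁ (proj₂ (proj₁ (proj₁ i))))
    ... | _ , _ , _ , far refl h , _                    = true≢false s (proj₁ (proj₂ (proj₁ (proj₁ (far-I h)))))
    ... | _ , _ , _ , matched (l , _) _ , _             = true≢false s (proj₁ (proj₂ l))

    E-back : ∀ {u v} → X u v → sel v u ≡ true → E main (col v) u v ≡ 3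
    E-back {u} {v} x s with labelled-as x
    ... | _ , _ , _ , head refl (back _ _) , e          = e
    ... | _ , _ , _ , home refl (selected s′) , _       = true≢false s′ (proj₂ (proj₂ (sel-back x s)))
    ... | _ , _ , _ , home refl (hit l _) , _           = true≢false s (proj₂ (proj₂ l))
    ... | _ , _ , _ , home refl (miss l _ _) , _        = true≢false s (proj₂ (proj₂ l))
    ... | _ , _ , _ , home refl (pendant (l , _)) , _   = true≢false s (proj₂ (proj₂ l))
    ... | _ , _ , _ , home refl (star (l , _)) , _      = true≢false s (proj₂ (proj₂ l))
    ... | _ , _ , _ , home refl (leaf i _ _ _ _) , _    = true≢false s (proj₂ (proj₂ (proj₁ (proj₁ i))))
    ... | _ , _ , _ , head refl (assigned i _) , _      = true≢false s (proj₂ (proj₂ (proj₁ (proj₁ i))))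
    ... | _ , _ , _ , head refl (star i _) , _          = true≢false s (proj₂ (proj₂ (proj₁ (proj₁ i))))
    ... | _ , _ , _ , head refl (pendant i _) , _       = true≢false s (proj₂ (proj₂ (proj₁ (proj₁ i))))
    ... | _ , _ , _ , far refl h , _                    = true≢false s (proj₂ (proj₂ (proj₁ (proj₁ (far-I h)))))
    ... | _ , _ , _ , matched (l , _) _ , _             = true≢false s (proj₂ (proj₂ l))

    -- Sums in each kind of part.

    main-multiple : ∀ j u v → 3 ∣ E main j u v
    main-multiple j u v with E main j u v | contribution main j u v
    ... | _ | none                          = 3 ∣0
    ... | _ | some _ (home _ (selected _))       = ∣-refl
    ... | _ | some _ (home _ (leaf _ _ _ _ _))   = ∣-refl
    ... | _ | some _ (head _ (back _ _))         = ∣-refl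
    ... | _ | some _ (far _ (selected _ _ _))    = ∣-refl

    main-zero : ∀ {j x} → col x ≢ j → 3 ∣ W main j x
    main-zero {j} {x} ne = subst (3 ∣_) (≡-sym (W-foreign {main} {j} {x} (ne ∘ proj₂)))
      (∣m∣n⇒∣m+n (∣-sum _ (main-multiple j x)) (∣-sum _ λ y → main-multiple j y x))

    -- The edges of this part at an active `x` are those inside the class and those picked by
    -- `sel x`, each of the latter with weight 3. An edge of type `leaf` leaving `x` would
    -- contradict activity.
    W-active : ∀ {x} → Active x → W main (col x) x ≡ base x + count (sel x) * 3
    W-active {x} act = begin
      W main (col x) x
        ≡⟨ ∑-distrib-+ (O main (col x) x) _ ⟩
      sum (O main (col x) x) + sum (λ y → E main (col x) x y + E main (col x) y x)
        ≡⟨ cong₂ _+_ (sum-cong-≗ owned) (sum-cong-≗ extra) ⟩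
      base x + sum (λ y → 𝟙 (sel x y) * 3)
        ≡⟨ cong (base x +_) (*-distribʳ-sum 3 (λ y → 𝟙 (sel x y))) ⟨
      base x + count (sel x) * 3 ∎
      where
      open ≡-Reasoning
      owned : ∀ y → O main (col x) x y ≡ (if own x y then weightVal (g x y) else 0)
      owned y = cong (λ s → if own x y then s else 0) (pay-same main (col x) (g x y))
      out-zero : ∀ y → sel x y ≡ false → E main (col x) x y ≡ 0
      out-zero y s with E main (col x) x y | contribution main (col x) x y
      ... | _ | none = refl
      ... | _ | some x′ vw with out-home (λ ()) refl x′ vw
      ...   | selected s′        = true≢false s′ s
      ...   | leaf _ lone _ _ _  = contradiction lone (Active⇒¬Lone x′ act)
      in-zero : ∀ y → sel x y ≡ false → E main (col x) y x ≡ 0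
      in-zero y s with E main (col x) y x | contribution main (col x) y x
      ... | _ | none = refl
      ... | _ | some x′ vw with in-head (λ ()) refl x′ vw
      ...   | back _ s′ = true≢false s′ s
      extra : ∀ y → E main (col x) x y + E main (col x) y x ≡ 𝟙 (sel x y) * 3
      extra y with sel x y in s
      ... | false = cong₂ _+_ (out-zero y s) (in-zero y s)
      ... | true with sel-Candidate s
      ...   | _ , inj₁ x′       = cong₂ _+_ (E-selected x′ s) (E-¬X {main} {col x} (X-asym x′))
      ...   | _ , inj₂ (x′ , _) = cong₂ _+_ (E-¬X {main} {col x} (X-asym x′)) (E-back x′ s)

    main-nonzero : ∀ {x} → Active x → ¬ 3 ∣ W main (col x) x
    main-nonzero {x} act d = base-nonzero act (∣m+n∣m⇒∣n
      (subst (3 ∣_) (trans (W-active act) (+-comm (base x) _)) d) (n∣m*n (count (sel x))))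

    own-distinct : ∀ {u v} → own u v ≡ true → W main (col u) u ≢ W main (col u) v
    own-distinct {u} {v} o e = sel-distinguishes o (trans (≡-sym (W-active (v , o)))
      (trans e (subst (λ j → W main j v ≡ base v + count (sel v) * 3) (proj₂ (own-Adj o))
        (W-active (u , trans (own-sym v u) o)))))

    W-lone : ∀ {u v} → X u v → Lone u v → W main (col u) u ≡ E main (col u) u v
    W-lone {u} {v} x lone = trans (sum-single (con main (col u) u) v away) at-v
      where
      away : ∀ y → y ≢ v → con main (col u) u y ≡ 0
      away y y≢v with own u y in o
      ... | true  = contradiction (lone y (proj₁ (own-Adj o))) y≢v
      ... | false = cong₂ _+_ (E-¬X {main} {col u} (λ x′ → y≢v (lone y (proj₁ x′))))
                              (E-¬X {main} {col u} (λ x′ → y≢v (lone y (Adj-sym (proj₁ x′)))))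
      at-v : con main (col u) u v ≡ E main (col u) u v
      at-v with own u v in o
      ... | true  = contradiction (trans (≡-sym (proj₂ x)) (proj₂ (own-Adj o))) next-≢
      ... | false = trans (cong (E main (col u) u v +_) (E-¬X {main} {col u} (X-asym x))) (+-identityʳ _)

    -- Only the edge to the assigned head has a weight other than 3 in this part, and that weight is
    -- 1 or 2.
    assign-nonzero : ∀ {x q} → to x ≡ just q → ¬ 3 ∣ W assign (col x) x
    assign-nonzero {x} {q} e d = ∤-sum (E assign (col x) x) q
      (subst (λ s → ¬ 3 ∣ s) (≡-sym (E-hit e)) (f-nonzero x)) others
      (∣m+n∣m⇒∣n (subst (3 ∣_) (trans (W-foreign {assign} {col x} {x} (not-main (λ ())))
        (+-comm (sum (E assign (col x) x)) _)) d) (∣-sum _ incoming))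
      where
      others : ∀ y → y ≢ q → 3 ∣ E assign (col x) x y
      others y y≢q with E assign (col x) x y | contribution assign (col x) x y
      ... | _ | none = 3 ∣0
      ... | _ | some x′ vw with out-home (λ ()) refl x′ vw
      ...   | hit _ e′             = contradiction (just-injective (trans (≡-sym e′) e)) y≢q
      ...   | miss _ _ _           = ∣-refl
      ...   | pendant (_ , e′ , _) = ∣-refl
      incoming : ∀ y → 3 ∣ E assign (col x) y x
      incoming y with E assign (col x) y x | contribution assign (col x) y x
      ... | _ | none = 3 ∣0
      ... | _ | some x′ vw with in-head (λ ()) refl x′ vw
      ...   | assigned _ _           = ∣-refl
      ...   | pendant _ (_ , e′ , _) = just≢nothing e e′

    -- The `hit` edges into `x` form a fibre of `to`, whose weights cancel modulo 3; everything else
    -- at `x` has weight 3.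
    assign-zero : ∀ {x j} → col x ≡ next j → 3 ∣ W assign j x
    assign-zero {x} {j} c = subst (3 ∣_) (≡-sym (W-foreign {assign} {j} {x} (not-main (λ ()))))
      (∣m∣n⇒∣m+n (∣-sum _ outgoing) (∣-sum-modified _ (λ y → E assign j y x) (f-fibre x) (λ y → incoming y (isJust? (to y) x))))
      where
      outgoing : ∀ y → 3 ∣ E assign j x y
      outgoing y with E assign j x y | contribution assign j x y
      ... | _ | none = 3 ∣0
      ... | _ | some x′ vw with out-far (λ ()) c x′ vw
      ...   | assigned _ _ = ∣-refl
      ...   | pendant _ _  = ∣-refl
      incoming : ∀ y (d : Dec (to y ≡ just x)) →
        E assign j y x ≡ (if does d then weightVal (f y) else 0) ⊎ ((if does d then weightVal (f y) else 0) ≡ 0 × 3 ∣ E assign j y x)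
      incoming y (yes e) = inj₁ (subst (λ i → E assign i y x ≡ weightVal (f y))
        (next-injective (trans (≡-sym (proj₂ (proj₁ (sound e)))) c)) (E-hit e))
      incoming y (no ne) = inj₂ (refl , multiple)
        where
        multiple : 3 ∣ E assign j y x
        multiple with E assign j y x | contribution assign j y x
        ... | _ | none = 3 ∣0
        ... | _ | some x′ vw with in-home (λ ()) c x′ vw
        ...   | hit _ e    = contradiction e ne
        ...   | miss _ _ _ = ∣-refl
        ...   | pendant _  = ∣-refl

    -- The only remaining edge leaving `u` contributes 3, and at most one attached edge contributes
    -- 1.
    assign-pendant≤4 : ∀ {u v} → Pendant u v → W assign (col u) u ≤ 4
    assign-pendant≤4 {u} {v} (_ , un , out , _) = subst (_≤ 4) (≡-sym (W-foreign {assign} {col u} {u} (not-main (λ ()))))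
      (+-mono-≤ (sum≤-unique (E assign (col u) u) (λ a b → trans (only a) (≡-sym (only b))) (E≤3 assign (col u) u))
                (sum≤-unique (λ y → E assign (col u) y u) unique-in small))
      where
      only : ∀ {y} → E assign (col u) u y ≢ 0 → y ≡ v
      only {y} ne with contributes assign (col u) u y ne
      ... | _ , x , vw with out-home (λ ()) refl x vw
      ...   | hit _ e       = just≢nothing e un
      ...   | miss _ e _    = just≢nothing e un
      ...   | pendant (l , _) = out _ l
      isolated : ∀ {y} → E assign (col u) y u ≢ 0 → M y u
      isolated {y} ne with contributes assign (col u) y u ne
      ... | _ , x , vw with in-head (λ ()) refl x vw
      ...   | assigned i _ = proj₁ i
      ...   | pendant i _  = proj₁ i
      unique-in : ∀ {y z} → E assign (col u) y u ≢ 0 → E assign (col u) z u ≢ 0 → y ≡ z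
      unique-in a b = proj₂ (proj₂ (isolated b)) _ (proj₁ (isolated a))
      small : ∀ y → E assign (col u) y u ≤ 1
      small y with E assign (col u) y u | contribution assign (col u) y u
      ... | _ | none = z≤n
      ... | _ | some x vw with in-head (λ ()) refl x vw
      ...   | pendant _ _              = ≤-refl
      ...   | assigned _ (_ , _ , e)   = just≢nothing e un

    -- By `unique` the other tail `p′` is assigned, so the head has at least 3 + 1, while the tail
    -- has at most 4. Equal sums would both be 4, but the sum of the head is divisible by 3.
    pendant-distinct : ∀ {u v} → Pendant u v → W assign (col u) u ≢ W assign (col u) v
    pendant-distinct {u} {v} p@(l , un , out , p′ , p′≢u , l′) e =
      from-no (3 ∣? 4) (subst (3 ∣_) (≤-antisym (subst (_≤ 4) e (assign-pendant≤4 p)) four) (assign-zero (proj₂ (proj₁ l))))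
      where
      other : 1 ≤ E assign (col u) p′ v
      other with to p′ in e′
      ... | nothing = contradiction (unique l′ l e′ un) p′≢u
      ... | just q  = subst (λ j → 1 ≤ E assign j p′ v) (same-tail-colour (proj₁ l′) (proj₁ l)) (E-assigned (l′ , q , e′))
      four : 4 ≤ W assign (col u) v
      four = ≤-trans (+-mono-≤ (≤-reflexive (≡-sym (E-pendant p))) other) (W≥-in-in assign (col u) v (p′≢u ∘ ≡-sym))

    -- By `unique` only one star reaches `v`, with weight 3; at most one attached edge adds 1.
    stars-leaf≤4 : ∀ {u v} → Star u v → W stars (col u) v ≤ 4
    stars-leaf≤4 {u} {v} (l , un , _) = subst (_≤ 4) (≡-sym (W-foreign {stars} {col u} {v} (not-main (λ ()))))
      (subst (_≤ 4) (+-comm (sum (λ y → E stars (col u) y v)) _)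
        (+-mono-≤ (sum≤-unique (λ y → E stars (col u) y v) (λ a b → trans (only a) (≡-sym (only b))) (λ y → E≤3 stars (col u) y v))
                  (sum≤-unique (E stars (col u) v) unique-out small)))
      where
      only : ∀ {y} → E stars (col u) y v ≢ 0 → y ≡ u
      only {y} ne with contributes stars (col u) y v ne
      ... | _ , x , vw with in-home (λ ()) (proj₂ (proj₁ l)) x vw
      ...   | star (l′ , un′ , _) = unique l′ l un′ un
      isolated : ∀ {y} → E stars (col u) v y ≢ 0 → M v y
      isolated {y} ne with contributes stars (col u) v y ne
      ... | _ , x , vw = proj₁ (far-I (out-far (λ ()) (proj₂ (proj₁ l)) x vw))
      unique-out : ∀ {y z} → E stars (col u) v y ≢ 0 → E stars (col u) v z ≢ 0 → y ≡ z
      unique-out a b = proj₁ (proj₂ (isolated b)) _ (proj₁ (isolated a))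
      small : ∀ y → E stars (col u) v y ≤ 1
      small y with E stars (col u) v y | contribution stars (col u) v y
      ... | _ | none = z≤n
      ... | _ | some x vw with out-far (λ ()) (proj₂ (proj₁ l)) x vw
      ...   | star _ _ = ≤-refl

    -- Two edges of weight 3 give the centre at least 6.
    star-distinct : ∀ {u v} → Star u v → W stars (col u) u ≢ W stars (col u) v
    star-distinct {u} {v} st@(l , un , q′ , q′≢v , l′) e = contradiction
      (≤-trans (≤-trans (+-mono-≤ (≤-reflexive (≡-sym (E-star st))) (≤-reflexive (≡-sym (E-star (l′ , un , v , q′≢v ∘ ≡-sym , l)))))
                        (W≥-out-out stars (col u) u (q′≢v ∘ ≡-sym)))
               (subst (_≤ 4) (≡-sym e) (stars-leaf≤4 st)))
      (from-no (6 ℕ.≤? 4))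

    E-paths : ∀ {u v} → M u v → (∃ λ y → M y u) ⊎ (∃ λ y → M v y) → E paths 0F u v ≡ weightVal (col u)
    E-paths {u} {v} m@(l , out , inn) adjacent with labelled-as (proj₁ l)
    ... | _ , _ , _ , matched _ _ , e                    = e
    ... | _ , _ , _ , home refl (selected s) , _         = true≢false s (proj₁ (proj₂ l))
    ... | _ , _ , _ , home refl (hit _ e) , _            = contradiction e (matched-unassigned m)
    ... | _ , _ , _ , home refl (miss _ e _) , _         = contradiction e (matched-unassigned m)
    ... | _ , _ , _ , home refl (pendant (_ , _ , _ , p′ , p′≢ , l′)) , _ = contradiction (inn p′ l′) p′≢
    ... | _ , _ , _ , home refl (star (_ , _ , q′ , q′≢ , l′)) , _        = contradiction (out q′ l′) q′≢
    ... | _ , _ , _ , home refl (leaf i _ _ _ _) , _     = ⊥-elim ([ proj₁ (proj₂ i) , proj₂ (proj₂ i) ]′ adjacent)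
    ... | _ , _ , _ , head refl (back _ s) , _           = true≢false s (proj₂ (proj₂ l))
    ... | _ , _ , _ , head refl (assigned i _) , _       = ⊥-elim ([ proj₁ (proj₂ i) , proj₂ (proj₂ i) ]′ adjacent)
    ... | _ , _ , _ , head refl (star i _) , _           = ⊥-elim ([ proj₁ (proj₂ i) , proj₂ (proj₂ i) ]′ adjacent)
    ... | _ , _ , _ , head refl (pendant i _) , _        = ⊥-elim ([ proj₁ (proj₂ i) , proj₂ (proj₂ i) ]′ adjacent)
    ... | _ , _ , _ , far refl h , _                     = ⊥-elim ([ proj₁ (proj₂ (far-I h)) , proj₂ (proj₂ (far-I h)) ]′ adjacent)

    paths-M : ∀ {j u v w} → View u v paths j w → M u v
    paths-M (matched m _) = m

    paths-zero : ∀ {j u v} → ¬ M u v → E paths j u v ≡ 0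
    paths-zero {j} {u} {v} ¬m with E paths j u v | contribution paths j u v
    ... | _ | none      = refl
    ... | _ | some _ vw = contradiction (paths-M vw) ¬m

    paths-out : ∀ {u v} → M u v → (∃ λ y → M y u) ⊎ (∃ λ y → M v y) → sum (E paths 0F u) ≡ weightVal (col u)
    paths-out {u} {v} m adjacent = trans (sum-single (E paths 0F u) v
      (λ y y≢v → paths-zero (λ m′ → y≢v (proj₁ (proj₂ m) y (proj₁ m′))))) (E-paths m adjacent)

    paths-in : ∀ {u v} → M u v → (∃ λ y → M y u) ⊎ (∃ λ y → M v y) → sum (λ y → E paths 0F y v) ≡ weightVal (col u)
    paths-in {u} {v} m adjacent = trans (sum-single (λ y → E paths 0F y v) u
      (λ y y≢u → paths-zero (λ m′ → y≢u (proj₂ (proj₂ m) y (proj₁ m′))))) (E-paths m adjacent)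

    -- The weight of `u → v` cancels, leaving the edge of `M` into `u` against the one out of `v`.
    -- If only one exists, a positive weight faces 0; if both exist, their tails lie in different
    -- classes and the weights differ.
    matched-distinct : ∀ {u v} → M u v → (∃ λ y → M y u) ⊎ (∃ λ y → M v y) → W paths 0F u ≢ W paths 0F v
    matched-distinct {u} {v} m adjacent e = go (any? (λ y → M? y u)) (any? (λ y → M? v y))
      where
      sides : sum (λ y → E paths 0F y u) ≡ sum (E paths 0F v)
      sides = +-cancelˡ-≡ (weightVal (col u)) _ _ (begin
        weightVal (col u) + sum (λ y → E paths 0F y u)
          ≡⟨ cong (_+ sum (λ y → E paths 0F y u)) (paths-out m adjacent) ⟨
        sum (E paths 0F u) + sum (λ y → E paths 0F y u) ≡⟨ W-foreign {paths} {0F} {u} (not-main (λ ())) ⟨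
        W paths 0F u ≡⟨ e ⟩
        W paths 0F v ≡⟨ W-foreign {paths} {0F} {v} (not-main (λ ())) ⟩
        sum (E paths 0F v) + sum (λ y → E paths 0F y v) ≡⟨ cong (sum (E paths 0F v) +_) (paths-in m adjacent) ⟩
        sum (E paths 0F v) + weightVal (col u) ≡⟨ +-comm (sum (E paths 0F v)) _ ⟩
        weightVal (col u) + sum (E paths 0F v) ∎)
        where open ≡-Reasoning
      in-none : ¬ (∃ λ y → M y u) → sum (λ y → E paths 0F y u) ≡ 0
      in-none ¬p = sum-zero _ (λ y → paths-zero (λ m′ → ¬p (y , m′)))
      out-none : ¬ (∃ λ y → M v y) → sum (E paths 0F v) ≡ 0
      out-none ¬p = sum-zero _ (λ y → paths-zero (λ m′ → ¬p (y , m′)))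
      go : Dec (∃ λ y → M y u) → Dec (∃ λ y → M v y) → ⊥
      go (no ¬p) (no ¬q) = [ ¬p , ¬q ]′ adjacent
      go (yes (y , m′)) (no ¬q) = case trans (≡-sym (paths-in m′ (inj₂ (v , m)))) (trans sides (out-none ¬q)) of λ ()
      go (no ¬p) (yes (y , m′)) = case trans (≡-sym (paths-out m′ (inj₁ (u , m)))) (trans (≡-sym sides) (in-none ¬p)) of λ ()
      go (yes (y , m′)) (yes (z , m″)) = next-≢ (trans
        (≡-sym (third-colour (proj₁ (proj₁ m′)) (proj₁ (proj₁ m))))
        (toℕ-injective (cong ℕ.pred (trans (≡-sym (paths-in m′ (inj₂ (v , m)))) (trans sides (paths-out m″ (inj₁ (u , m))))))))

    -- For an attached edge, the pendant end has just the weight of that edge as its sum, while the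
    -- other end has a larger sum or one that is nonzero modulo 3. Edges of the types `selected`,
    -- `back`, `hit` and `miss` are settled by residues.
    distinct : ∀ {u v k j w} → X u v → View u v k j w → E k j u v ≡ weightVal w → W k j u ≢ W k j v
    distinct {u} {v} x (home refl (selected s)) _ e = main-nonzero (sel-X x s)
      (subst (3 ∣_) (≡-sym e) (main-zero (λ c → next-≢ (trans (≡-sym (proj₂ x)) c))))
    distinct x (home refl (hit _ a)) _ e    = assign-nonzero a (subst (3 ∣_) (≡-sym e) (assign-zero (proj₂ x)))
    distinct x (home refl (miss _ a _)) _ e = assign-nonzero a (subst (3 ∣_) (≡-sym e) (assign-zero (proj₂ x)))
    distinct x (home refl (pendant p)) _    = pendant-distinct p
    distinct x (home refl (star s)) _       = star-distinct s
    distinct {u} {v} x (home refl (leaf {y} i lone y≢u xy s)) eq e = contradiction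
      (≤-trans (≤-trans (+-mono-≤ (≤-reflexive (≡-sym eq)) (≤-reflexive (≡-sym
          (subst (λ j → E main j y v ≡ 3) (same-tail-colour xy x) (E-selected xy s)))))
        (W≥-in-in main (col u) v (y≢u ∘ ≡-sym)))
        (≤-reflexive (trans (≡-sym e) (trans (W-lone x lone) eq))))
      (from-no (6 ℕ.≤? 3))
    distinct {u} {v} x (head refl (back _ s)) _ e = main-nonzero (proj₁ (proj₂ (sel-back x s)))
      (subst (3 ∣_) e (main-zero (λ c → next-≢ (trans (≡-sym (proj₂ x)) (≡-sym c)))))
    distinct {u} {v} x (head refl (assigned i (_ , _ , a))) eq e = assign-nonzero a
      (subst (3 ∣_) (trans (≡-sym (trans (third-out assign (λ ()) i) eq)) e) ∣-refl)
    distinct {u} {v} x (head refl (star {y} i s)) eq e = contradiction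
      (≤-trans (≤-trans (≤-reflexive (≡-sym (E-star s))) (W≥-out stars (col v) v y))
               (≤-reflexive (trans (≡-sym e) (trans (third-out stars (λ ()) i) eq))))
      (from-no (3 ℕ.≤? 1))
    distinct {u} {v} x (head refl (pendant {y} i p)) eq e = contradiction
      (≤-trans (≤-trans (≤-reflexive (≡-sym (E-pendant p))) (W≥-out assign (col v) v y))
               (≤-reflexive (trans (≡-sym e) (trans (third-out assign (λ ()) i) eq))))
      (from-no (3 ℕ.≤? 1))
    distinct {u} {v} x (far refl (selected {y} i xy s)) eq e = contradiction
      (≤-trans (≤-trans (+-mono-≤ (≤-reflexive (≡-sym eq)) (≤-reflexive (≡-sym
          (subst (λ j → E main j y u ≡ 3) (third-colour xy x) (E-selected xy s)))))
        (W≥-out-in main (next (col v)) u (X-chain-≢ xy x ∘ ≡-sym)))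
        (≤-reflexive (trans e (trans (third-in main (λ ()) i) eq))))
      (from-no (6 ℕ.≤? 3))
    distinct {u} {v} x (far refl (assigned {y} i a)) eq e = contradiction
      (≤-trans (≤-trans (+-mono-≤ (≤-reflexive (≡-sym eq))
          (subst (λ j → 1 ≤ E assign j y u) (third-colour (proj₁ (proj₁ a)) x) (E-assigned a)))
        (W≥-out-in assign (next (col v)) u (X-chain-≢ (proj₁ (proj₁ a)) x ∘ ≡-sym)))
        (≤-reflexive (trans e (trans (third-in assign (λ ()) i) eq))))
      (from-no (4 ℕ.≤? 3))
    distinct {u} {v} x (far refl (pendant {y} i p)) eq e = contradiction
      (≤-trans (≤-trans (+-mono-≤ (≤-reflexive (≡-sym eq)) (≤-reflexive (≡-sym
          (subst (λ j → E assign j y u ≡ 3) (third-colour (proj₁ (proj₁ p)) x) (E-pendant p)))))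
        (W≥-out-in assign (next (col v)) u (X-chain-≢ (proj₁ (proj₁ p)) x ∘ ≡-sym)))
        (≤-reflexive (trans e (trans (third-in assign (λ ()) i) eq))))
      (from-no (6 ℕ.≤? 3))
    distinct {u} {v} x (far refl (star {y} i s)) eq e = contradiction
      (≤-trans (≤-trans (≤-reflexive (≡-sym
          (subst (λ j → E stars j y u ≡ 3) (third-colour (proj₁ (proj₁ s)) x) (E-star s))))
        (W≥-in stars (next (col v)) u y))
        (≤-reflexive (trans e (trans (third-in stars (λ ()) i) eq))))
      (from-no (3 ℕ.≤? 1))
    distinct x (matched m adjacent) _ = matched-distinct m adjacent

    -- The decomposition.

    Trichotomy : Fin n → Fin n → Set
    Trichotomy x y = (col y ≡ col x) ⊎ (col y ≡ next (col x)) ⊎ (col x ≡ next (col y))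

    labelBy : ∀ x y → Trichotomy x y → Label
    labelBy x y (inj₁ _)        = main , col x , g x y
    labelBy x y (inj₂ (inj₁ _)) = lab x y
    labelBy x y (inj₂ (inj₂ _)) = lab y x

    label : Fin n → Fin n → Label
    label x y = labelBy x y (colours x y)

    -- From either end an oriented edge is looked up in its own direction, so only edges inside a
    -- class need `g-sym`; the inconsistent cases contradict the cyclic order.
    labelBy-sym : ∀ x y (t : Trichotomy x y) (t′ : Trichotomy y x) → labelBy x y t ≡ labelBy y x t′
    labelBy-sym x y (inj₁ e)        (inj₁ _)         = cong₂ (λ j w → main , j , w) (≡-sym e) (g-sym x y)
    labelBy-sym x y (inj₁ e)        (inj₂ (inj₁ e′)) = contradiction (trans (≡-sym e′) (≡-sym e)) next-≢
    labelBy-sym x y (inj₁ e)        (inj₂ (inj₂ e′)) = contradiction (trans (≡-sym e′) e) next-≢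
    labelBy-sym x y (inj₂ (inj₁ e)) (inj₁ e′)        = contradiction (trans (≡-sym e) (≡-sym e′)) next-≢
    labelBy-sym x y (inj₂ (inj₁ e)) (inj₂ (inj₁ e′)) = contradiction (trans (cong next (≡-sym e)) (≡-sym e′)) next²-≢
    labelBy-sym x y (inj₂ (inj₁ _)) (inj₂ (inj₂ _))  = refl
    labelBy-sym x y (inj₂ (inj₂ e)) (inj₁ e′)        = contradiction (trans (≡-sym e) e′) next-≢
    labelBy-sym x y (inj₂ (inj₂ _)) (inj₂ (inj₁ _))  = refl
    labelBy-sym x y (inj₂ (inj₂ e)) (inj₂ (inj₂ e′)) = contradiction (trans (cong next (≡-sym e)) (≡-sym e′)) next²-≢

    c : Fin n → Fin n → Fin 24
    c x y = let k , j , _ = label x y in enc k j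

    w : Fin n → Fin n → Fin 3
    w x y = proj₂ (proj₂ (label x y))

    label-sym : ∀ x y → label x y ≡ label y x
    label-sym x y = labelBy-sym x y (colours x y) (colours y x)

    c-sym : ∀ x y → c x y ≡ c y x
    c-sym x y = cong (λ (k , j , _) → enc k j) (label-sym x y)

    w-sym : ∀ x y → w x y ≡ w y x
    w-sym x y = cong (proj₂ ∘ proj₂) (label-sym x y)

    O-own : ∀ {k j x y} → Adj x y → col y ≡ col x → O k j x y ≡ pay (main , col x , g x y) k j
    O-own {k} {j} {x} {y} xy e rewrite own-true xy e = refl

    O-¬own : ∀ {k j x y} → ¬ (Adj x y × col y ≡ col x) → O k j x y ≡ 0
    O-¬own {k} {j} {x} {y} ne with own x y in o
    ... | true  = contradiction (own-Adj o) ne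
    ... | false = refl

    -- On an edge the trichotomy kills all terms of `con` but the one that `labelBy` refers to; on a
    -- non-edge all of them vanish.
    pay≡con : ∀ k j x y (t : Trichotomy x y) → (if adj G x y then pay (labelBy x y t) k j else 0) ≡ con k j x y
    pay≡con k j x y t = go (adj G x y) refl t
      where
      go : ∀ b → adj G x y ≡ b → (t : Trichotomy x y) → (if b then pay (labelBy x y t) k j else 0) ≡ con k j x y
      go false e t = ≡-sym (cong₂ _+_ (O-¬own {k} {j} λ (xy , _) → true≢false xy e) (cong₂ _+_
        (E-¬X {k} {j} {x} {y} λ (xy , _) → true≢false xy e)
        (E-¬X {k} {j} {y} {x} λ (yx , _) → true≢false (Adj-sym yx) e)))
      go true e (inj₁ s) = ≡-sym (trans (cong₂ _+_ (O-own {k} {j} e s) (cong₂ _+_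
        (E-¬X {k} {j} {x} {y} λ (_ , e′) → next-≢ (trans (≡-sym e′) s))
        (E-¬X {k} {j} {y} {x} λ (_ , e′) → next-≢ (trans (≡-sym e′) (≡-sym s))))) (+-identityʳ _))
      go true e (inj₂ (inj₁ s)) = ≡-sym (trans
        (cong₂ _+_ (O-¬own {k} {j} λ (_ , e′) → next-≢ (trans (≡-sym s) e′)) (cong₂ _+_
          (E-X {k} {j} {x} {y} (e , s)) (E-¬X {k} {j} {y} {x} (X-asym (e , s))))) (+-identityʳ _))
      go true e (inj₂ (inj₂ s)) = ≡-sym
        (cong₂ _+_ (O-¬own {k} {j} λ (_ , e′) → next-≢ (trans (≡-sym s) (≡-sym e′))) (cong₂ _+_
          (E-¬X {k} {j} {x} {y} (X-asym (Adj-sym e , s))) (E-X {k} {j} {y} {x} (Adj-sym e , s))))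

    -- `wsum` reads each edge from the neighbour `y`, `W` from `x`; the symmetry of `G` and of
    -- `label` reconciles them.
    wsum≡W : ∀ k j x → wsum (part G c c-sym (enc k j)) w x ≡ W k j x
    wsum≡W k j x = trans (Σv≡sum λ y → if adj G y x ∧ does (c y x ≟ enc k j) then weightVal (w y x) else 0)
      (sum-cong-≗ λ y → trans (paid (adj G y x) (label y x) (Graph.sym G y x) (label-sym y x)) (pay≡con k j x y (colours x y)))
      where
      paid : ∀ b l {b′ l′} → b ≡ b′ → l ≡ l′ →
             (if b ∧ does (enc (proj₁ l) (proj₁ (proj₂ l)) ≟ enc k j) then weightVal (proj₂ (proj₂ l)) else 0)
             ≡ (if b′ then pay l′ k j else 0)
      paid true  l refl refl = refl
      paid false l refl refl = refl

    distinctBy : ∀ {u v} → Adj u v → (t : Trichotomy u v) → let k , j , _ = labelBy u v t in W k j u ≢ W k j v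
    distinctBy uv (inj₁ e) = own-distinct (own-true uv e)
    distinctBy {u} {v} uv (inj₂ (inj₁ e)) =
      distinct x (view x) (proj₂ (proj₂ (proj₂ (proj₂ (labelled-as x)))))
      where
      x : X u v
      x = uv , e
    distinctBy {u} {v} uv (inj₂ (inj₂ e)) =
      distinct x (view x) (proj₂ (proj₂ (proj₂ (proj₂ (labelled-as x))))) ∘ ≡-sym
      where
      x : X v u
      x = Adj-sym uv , e

    fulfilled : ∀ i → Fulfills123 (part G c c-sym i)
    fulfilled i = w , w-sym , distinguished
      where
      distinguished : ∀ u v → adj G u v ∧ does (c u v ≟ i) ≡ true →
                      wsum (part G c c-sym i) w u ≢ wsum (part G c c-sym i) w v
      distinguished u v e eq with ∧-true e
      ... | uv , ci with does-true (c u v ≟ i) ci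
      ...   | refl = distinctBy uv (colours u v)
        (let k , j , _ = label u v in trans (≡-sym (wsum≡W k j u)) (trans eq (wsum≡W k j v)))

theorem8 : ∀ (n : ℕ) (G : Graph n) → HasNoIsolatedEdge G →
    Σ (Fin n → Fin n → Fin 24) λ c →
      Σ (∀ u v → c u v ≡ c v u) λ csym →
        ∀ (i : Fin 24) → Fulfills123 (part G c csym i)
theorem8 n G noIso = c , c-sym , fulfilled
  where
  colouring = LocalMaxCut.locallyMaximal G
  col = proj₁ colouring
  S = Coloured.Select.selection G col (proj₂ colouring)
  open Labelling G noIso col S
  P = partialAssignment L L?
  fibres = fibreWeights (PartialAssignment.to P) (PartialAssignment.shared P)
  f = proj₁ fibres
  open Verification.Weights G noIso col S P f (proj₁ (proj₂ fibres)) (proj₂ (proj₂ fibres)) (Labels.labelling P f)
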